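{- Let $A$ and $B$ be partial combinatory algebras and let $\gamma:A\to B$ be a computationally dense applicative morphism. Then $\gamma$ induces an inclusion of toposes $\mathsf{RT}(B)\to\mathsf{RT}(A)$ (that is, the geometric morphism induced by $\gamma$ is an inclusion) if and only if there is an applicative morphism $\delta:B\to A$ such that $\gamma\delta\simeq\mathrm{id}_B$.
   Context: Partial combinatory algebras. A pca is a set $A$ with a partial binary application $(a,b)\mapsto ab$ (associating to the left) for which there exist $\mathsf{k},\mathsf{s}\in A$ such that for all $a,b,c\in A$: $\mathsf{k}ab=a$; $\mathsf{s}ab$ is defined; and whenever $ac(bc)$ is defined, $\mathsf{s}abc$ is defined and equal to it. $t{\downarrow}$ means "$t$ is defined". For $b\in B$, $\beta\subseteq B$: $b\beta{\downarrow}$ means $bx{\downarrow}$ for all $x\in\beta$, and then $b\beta=\{bx\mid x\in\beta\}$. Applicative morphisms. An applicative morphism $\gamma:A\to B$ assigns to each $a\in A$ a nonempty subset $\gamma(a)\subseteq B$ such that there is $r\in B$ with: whenever $aa'{\downarrow}$, $b\in\gamma(a)$, $b'\in\gamma(a')$, then $rbb'{\downarrow}$ and $rbb'\in\gamma(aa')$. For $\gamma,\delta:A\to B$, $\gamma\leq\delta$ means there is $s\in B$ such that for all $a\in A$, $b\in\gamma(a)$: $sb{\downarrow}$ and $sb\in\delta(a)$; $\gamma\simeq\delta$ means $\gamma\leq\delta$ and $\delta\leq\gamma$. Composition is composition of relations: $(\delta\gamma)(a)=\bigcup_{b\in\gamma(a)}\delta(b)$; $\mathrm{id}_B(b)=\{b\}$.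 Computational density. $\gamma:A\to B$ is computationally dense if there is $m\in B$ such that for every $b\in B$ there is $a\in A$ such that for all $a'\in A$: if $b\gamma(a'){\downarrow}$ then $aa'{\downarrow}$, $m\gamma(aa'){\downarrow}$ and $m\gamma(aa')\subseteq b\gamma(a')$. Assemblies and toposes. $\mathrm{Ass}(A)$ has as objects pairs $(X,E)$ with $X$ a set and $E(x)\subseteq A$ nonempty for each $x\in X$; a morphism $(X,E)\to(Y,F)$ is a function $f:X\to Y$ for which some $a\in A$ satisfies $ab{\downarrow}$ and $ab\in F(f(x))$ for all $x\in X$, $b\in E(x)$. The realizability topos $\mathsf{RT}(A)$ is the exact completion of $\mathrm{Ass}(A)$ as a regular category (ex/reg completion). An applicative morphism $\gamma:A\to B$ gives a regular functor $\gamma^*:\mathrm{Ass}(A)\to\mathrm{Ass}(B)$, $(X,E)\mapsto(X,\gamma\circ E)$ with $(\gamma\circ E)(x)=\bigcup_{a\in E(x)}\gamma(a)$, identity on underlying functions, which extends essentially uniquely to a regular functor $\gamma^*:\mathsf{RT}(A)\to\mathsf{RT}(B)$. If $\gamma$ is computationally dense, $\gamma^*$ has a right adjoint (known), and the geometric morphism $\mathsf{RT}(B)\to\mathsf{RT}(A)$ induced by $\gamma$ is the one with inverse image $\gamma^*$. -}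

module Defs where

open import Level using (Level; _⊔_) renaming (suc to lsuc)
open import Data.Nat.Base using (ℕ) renaming (suc to 1+)
open import Data.Fin.Base using (Fin; zero; suc)
open import Data.Vec.Base using (Vec; []; _∷_; lookup)
open import Data.Product.Base using (Σ; Σ-syntax; ∃; ∃₂; _×_; _,_; proj₁; proj₂)
open import Data.Unit.Polymorphic.Base using (⊤; tt)
open import Function.Bundles using (Func)
open import Relation.Binary.Bundles using (Setoid)
open import Relation.Binary.Structures using (IsEquivalence)
open import Relation.Unary using (Pred; _∈_; _⊆_; Satisfiable)
import Relation.Binary.Reasoning.Setoid as SetoidReasoning

-- Sets are setoids throughout, since images in the category of assemblies already
-- need quotients of sets.  Subsets and functions respect the
-- setoid equalities, and "there is" is Σ.

------------------------------------------------------------------------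
-- Partial combinatory algebras

-- The partial application is given by its graph: a · b ↦ c says that ab is
-- defined and equal to c.  Definedness is not assumed decidable.

record PartialApplicativeStructure (ℓ : Level) : Set (lsuc ℓ) where
  field
    setoid : Setoid ℓ ℓ

  open Setoid setoid public
    using (Carrier; _≈_) renaming (refl to ≈-refl; sym to ≈-sym; trans to ≈-trans)

  infix 4 _·_↦_
  field
    _·_↦_        : Carrier → Carrier → Carrier → Set ℓ
    ↦-resp       : ∀ {a a′ b b′ c c′} → a ≈ a′ → b ≈ b′ → c ≈ c′ →
                   a · b ↦ c → a′ · b′ ↦ c′
    ↦-functional : ∀ {a b c c′} → a · b ↦ c → a · b ↦ c′ → c ≈ c′

  infixl 7 _∙_
  data Term (n : ℕ) : Set ℓ where
    var : Fin n → Term n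
    con : Carrier → Term n
    _∙_ : Term n → Term n → Term n

  infix 4 _[_]⇓_ _⇓_
  data _[_]⇓_ {n} : Term n → Vec Carrier n → Carrier → Set ℓ where
    ⇓var : ∀ {i ρ v} → lookup ρ i ≈ v → var i [ ρ ]⇓ v
    ⇓con : ∀ {a ρ v} → a ≈ v → con a [ ρ ]⇓ v
    ⇓app : ∀ {t u ρ f x v} → t [ ρ ]⇓ f → u [ ρ ]⇓ x → f · x ↦ v → t ∙ u [ ρ ]⇓ v

  _⇓_ : Term 0 → Carrier → Set ℓ
  t ⇓ v = t [ [] ]⇓ v

  infix 4 _↓
  _↓ : Term 0 → Set ℓ
  t ↓ = ∃ λ v → t ⇓ v

  _·ˢ_↓ : Carrier → Pred Carrier ℓ → Set ℓ
  b ·ˢ β ↓ = ∀ {x} → x ∈ β → ∃ λ y → b · x ↦ y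

  infixl 7 _·ˢ_
  _·ˢ_ : Carrier → Pred Carrier ℓ → Pred Carrier ℓ
  (b ·ˢ β) y = ∃ λ x → (x ∈ β) × (b · x ↦ y)

record PCA (ℓ : Level) : Set (lsuc ℓ) where
  field
    structure : PartialApplicativeStructure ℓ

  open PartialApplicativeStructure structure public

  field
    k s   : Carrier
    k-law : ∀ a b → con k ∙ con a ∙ con b ⇓ a
    s-def : ∀ a b → con s ∙ con a ∙ con b ↓
    s-law : ∀ a b c v → con a ∙ con c ∙ (con b ∙ con c) ⇓ v →
            con s ∙ con a ∙ con b ∙ con c ⇓ v

module Combinators {ℓ : Level} (A : PCA ℓ) where
  open PCA A

  ⇓con-refl : ∀ {n} {ρ : Vec Carrier n} {a} → con a [ ρ ]⇓ a
  ⇓con-refl = ⇓con ≈-refl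

  ⇓var-refl : ∀ {n} {ρ : Vec Carrier n} {i} → var i [ ρ ]⇓ lookup ρ i
  ⇓var-refl = ⇓var ≈-refl

  app₁⁻ : ∀ {n} {ρ : Vec Carrier n} {t b v} → t ∙ con b [ ρ ]⇓ v →
          ∃ λ f → (t [ ρ ]⇓ f) × (f · b ↦ v)
  app₁⁻ (⇓app p (⇓con b≈) r) = _ , p , ↦-resp ≈-refl (≈-sym b≈) ≈-refl r

  app₂⁻ : ∀ {n} {ρ : Vec Carrier n} {a b c v} → con a ∙ con b ∙ con c [ ρ ]⇓ v →
          ∃ λ ab → (a · b ↦ ab) × (ab · c ↦ v)
  app₂⁻ p with app₁⁻ p
  ... | ab , q , ab·c with app₁⁻ q
  ... | _ , ⇓con a≈ , a·b = ab , ↦-resp (≈-sym a≈) ≈-refl ≈-refl a·b , ab·c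

  k-partial : ∀ a → ∃ λ ka → (k · a ↦ ka) × (∀ b → ka · b ↦ a)
  k-partial a with app₂⁻ (k-law a a)
  ... | ka , k·a , _ = ka , k·a , λ b → let (_ , k·a′ , p) = app₂⁻ (k-law a b) in
    ↦-resp (↦-functional k·a′ k·a) ≈-refl ≈-refl p

  s-partial : ∀ a b → ∃₂ λ sa sab → (s · a ↦ sa) × (sa · b ↦ sab) ×
    (∀ {c u v w} → a · c ↦ u → b · c ↦ v → u · v ↦ w → sab · c ↦ w)
  s-partial a b with s-def a b
  ... | sab , p with app₂⁻ p
  ... | sa , s·a , sa·b = sa , sab , s·a , sa·b , λ {c} q r t →
    let (_ , p′ , sab·c)  = app₁⁻ (s-law a b c _ (⇓app (⇓app ⇓con-refl ⇓con-refl q)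
                                                      (⇓app ⇓con-refl ⇓con-refl r) t))
        (_ , s·a′ , sa·b′) = app₂⁻ p′
        sab≈ = ↦-functional (↦-resp (↦-functional s·a′ s·a) ≈-refl ≈-refl sa·b′) sa·b
    in ↦-resp sab≈ ≈-refl ≈-refl sab·c

  -- Bracket abstraction
  ƛ_ : ∀ {n} → Term (1+ n) → Term n
  ƛ var zero    = con s ∙ con k ∙ con k
  ƛ var (suc i) = con k ∙ var i
  ƛ con a       = con k ∙ con a
  ƛ (t ∙ u)     = con s ∙ (ƛ t) ∙ (ƛ u)

  abstract
    ƛ-correct : ∀ {n} (t : Term (1+ n)) (ρ : Vec Carrier n) →
                ∃ λ f → ((ƛ t) [ ρ ]⇓ f) × (∀ {a v} → t [ a ∷ ρ ]⇓ v → f · a ↦ v)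
    ƛ-correct (var zero) ρ with s-partial k k
    ... | _ , skk , s·k , sk·k , β =
      skk , ⇓app (⇓app ⇓con-refl ⇓con-refl s·k) ⇓con-refl sk·k , λ { {a} (⇓var a≈) →
        let (ka , k·a , kβ) = k-partial a in ↦-resp ≈-refl ≈-refl a≈ (β k·a k·a (kβ ka)) }
    ƛ-correct (var (suc i)) ρ with k-partial (lookup ρ i)
    ... | kv , k·v , β = kv , ⇓app ⇓con-refl ⇓var-refl k·v ,
      λ { (⇓var v≈) → ↦-resp ≈-refl ≈-refl v≈ (β _) }
    ƛ-correct (con c) ρ with k-partial c
    ... | kc , k·c , β = kc , ⇓app ⇓con-refl ⇓con-refl k·c ,
      λ { (⇓con c≈) → ↦-resp ≈-refl ≈-refl c≈ (β _) }
    ƛ-correct (t ∙ u) ρ with ƛ-correct t ρ | ƛ-correct u ρ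
    ... | f , p , βf | g , q , βg with s-partial f g
    ... | _ , sfg , s·f , sf·g , β = sfg , ⇓app (⇓app ⇓con-refl p s·f) q sf·g ,
      λ { (⇓app tv uv r) → β (βf tv) (βg uv) r }

  fun : Term 1 → Carrier
  fun t = proj₁ (ƛ-correct t [])

  fun-β : ∀ (t : Term 1) {a v} → t [ a ∷ [] ]⇓ v → fun t · a ↦ v
  fun-β t = proj₂ (proj₂ (ƛ-correct t []))

  pattern 𝟎 = var zero
  pattern 𝟏 = var (suc zero)
  pattern 𝟐 = var (suc (suc zero))

  I : Carrier
  I = fun 𝟎

  I-β : ∀ {a} → I · a ↦ a
  I-β = fun-β 𝟎 ⇓var-refl

  K : Carrier → Carrier
  K a = fun (con a)

  K-β : ∀ {a b} → K a · b ↦ a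
  K-β {a} = fun-β (con a) ⇓con-refl

  infixr 9 _⋆_
  _⋆_ : Carrier → Carrier → Carrier
  b ⋆ a = fun (con b ∙ (con a ∙ 𝟎))

  ⋆-β : ∀ {a b x y z} → a · x ↦ y → b · y ↦ z → b ⋆ a · x ↦ z
  ⋆-β {a} {b} p q = fun-β (con b ∙ (con a ∙ 𝟎)) (⇓app ⇓con-refl (⇓app ⇓con-refl ⇓var-refl p) q)

  k̄ : Carrier
  k̄ = fun (ƛ 𝟎)

  k̄-β : ∀ a b → ∃ λ k̄a → (k̄ · a ↦ k̄a) × (k̄a · b ↦ b)
  k̄-β a b with ƛ-correct {1} 𝟎 (a ∷ [])
  ... | k̄a , e , β = k̄a , fun-β (ƛ 𝟎) e , β ⇓var-refl

  pair fst snd : Carrier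
  pair = fun (ƛ ƛ (𝟎 ∙ 𝟐 ∙ 𝟏))
  fst  = fun (𝟎 ∙ con k)
  snd  = fun (𝟎 ∙ con k̄)

  pair-β : ∀ a b → ∃₂ λ pa pab → (pair · a ↦ pa) × (pa · b ↦ pab) ×
           (fst · pab ↦ a) × (snd · pab ↦ b)
  pair-β a b with ƛ-correct {1} (ƛ (𝟎 ∙ 𝟐 ∙ 𝟏)) (a ∷ [])
  ... | pa , e , β with ƛ-correct {2} (𝟎 ∙ 𝟐 ∙ 𝟏) (b ∷ a ∷ [])
  ... | pab , e′ , β′ =
    let (_ , k·a , ka·b)  = k-partial a
        (_ , k̄·a , k̄a·b) = k̄-β a b
    in pa , pab , fun-β (ƛ ƛ (𝟎 ∙ 𝟐 ∙ 𝟏)) e , β e′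
     , fun-β (𝟎 ∙ con k) (⇓app ⇓var-refl ⇓con-refl
         (β′ (⇓app (⇓app ⇓var-refl ⇓var-refl k·a) ⇓var-refl (ka·b b))))
     , fun-β (𝟎 ∙ con k̄) (⇓app ⇓var-refl ⇓con-refl
         (β′ (⇓app (⇓app ⇓var-refl ⇓var-refl k̄·a) ⇓var-refl k̄a·b)))

------------------------------------------------------------------------
-- Applicative morphisms

record ApplicativeMorphism {ℓ : Level} (A B : PCA ℓ) : Set (lsuc ℓ) where
  private
    module A = PCA A
    module B = PCA B
  open B using (_∙_; con; _⇓_)
  field
    rel      : A.Carrier → Pred B.Carrier ℓ
    rel-resp : ∀ {a a′ b b′} → a A.≈ a′ → b B.≈ b′ → b ∈ rel a → b′ ∈ rel a′
    nonempty : ∀ a → Satisfiable (rel a)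
    r        : B.Carrier
    r-law    : ∀ {a a′ aa′ b b′} → a A.· a′ ↦ aa′ → b ∈ rel a → b′ ∈ rel a′ →
               ∃ λ v → (con r ∙ con b ∙ con b′ ⇓ v) × (v ∈ rel aa′)

module _ {ℓ : Level} {A B : PCA ℓ} (γ : ApplicativeMorphism A B) where
  private
    module A = PCA A
  open ApplicativeMorphism γ
  open PCA B
  open Combinators B using (app₂⁻)

  realize : ∀ {a a′ aa′ b b′} → a A.· a′ ↦ aa′ → b ∈ rel a → b′ ∈ rel a′ →
            ∃₂ λ u v → (r · b ↦ u) × (u · b′ ↦ v) × (v ∈ rel aa′)
  realize p q q′ =
    let (v , e , v∈) = r-law p q q′
        (u , r·b , u·b′) = app₂⁻ e
    in u , v , r·b , u·b′ , v∈

module _ {ℓ : Level} where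
  infix 4 _≤_ _≃_
  _≤_ : {A B : PCA ℓ} → ApplicativeMorphism A B → ApplicativeMorphism A B → Set ℓ
  _≤_ {A} {B} γ δ =
    Σ[ s ∈ B.Carrier ] (∀ a {b} → b ∈ γ.rel a → ∃ λ v → (s B.· b ↦ v) × (v ∈ δ.rel a))
    where
      module B = PCA B
      module γ = ApplicativeMorphism γ
      module δ = ApplicativeMorphism δ

  _≃_ : {A B : PCA ℓ} → ApplicativeMorphism A B → ApplicativeMorphism A B → Set ℓ
  γ ≃ δ = (γ ≤ δ) × (δ ≤ γ)

  idᵃ : (A : PCA ℓ) → ApplicativeMorphism A A
  idᵃ A = record
    { rel      = λ a b → a ≈ b
    ; rel-resp = λ a≈ b≈ p → ≈-trans (≈-sym a≈) (≈-trans p b≈)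
    ; nonempty = λ a → a , ≈-refl
    ; r        = I
    ; r-law    = λ p a≈b a′≈b′ →
        _ , ⇓app (⇓app ⇓con-refl (⇓con (≈-sym a≈b)) I-β) (⇓con (≈-sym a′≈b′)) p , ≈-refl
    }
    where open PCA A
          open Combinators A

  infixr 9 _∘ᵃ_
  _∘ᵃ_ : {A B C : PCA ℓ} → ApplicativeMorphism B C → ApplicativeMorphism A B →
         ApplicativeMorphism A C
  _∘ᵃ_ {A} {B} {C} δ γ = record
    { rel      = λ a c → ∃ λ b → (b ∈ γ.rel a) × (c ∈ δ.rel b)
    ; rel-resp = λ a≈ c≈ (b , p , q) →
        b , γ.rel-resp a≈ (PCA.≈-refl B) p , δ.rel-resp (PCA.≈-refl B) c≈ q
    ; nonempty = λ a → let (b , p) = γ.nonempty a ; (c , q) = δ.nonempty b in c , b , p , q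
    ; r        = fun composite
    ; r-law    = λ aa′ (b , p , q) (b′ , p′ , q′) →
        let (_ , bb′ , e , e′ , p″) = realize γ aa′ p p′
            (ρ , ρ∈)           = δ.nonempty γ.r
            (_ , _ , f , f′ , q₁) = realize δ e ρ∈ q
            (u , v , g , g′ , q₂) = realize δ e′ q₁ q′
        in v , ⇓app (⇓app ⇓con-refl ⇓con-refl (fun-β composite
                 (⇓app ⇓con-refl (⇓app (⇓app ⇓con-refl ⇓con-refl f) ⇓var-refl f′) g))) ⇓con-refl g′
             , bb′ , p″ , q₂
    }
    where
      module γ = ApplicativeMorphism γ
      module δ = ApplicativeMorphism δ
      open PCA C
      open Combinators C
      composite : Term 1
      composite = con δ.r ∙ (con δ.r ∙ con (proj₁ (δ.nonempty γ.r)) ∙ var zero)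

  ComputationallyDense : {A B : PCA ℓ} → ApplicativeMorphism A B → Set ℓ
  ComputationallyDense {A} {B} γ =
    Σ[ m ∈ B.Carrier ] ∀ (b : B.Carrier) → Σ[ a ∈ A.Carrier ] ∀ (a′ : A.Carrier) →
      b ·ˢ rel a′ ↓ →
      ∃ λ aa′ → (a A.· a′ ↦ aa′) × (m ·ˢ rel aa′ ↓) × (m ·ˢ rel aa′ ⊆ b ·ˢ rel a′)
    where
      module A = PCA A
      module B = PCA B
      open B using (_·ˢ_↓; _·ˢ_)
      open ApplicativeMorphism γ

------------------------------------------------------------------------
-- Categories and functors (hom-sets are setoids)

record Category (o h e : Level) : Set (lsuc (o ⊔ h ⊔ e)) where
  infix  4 _≈_ _⇒_
  infixr 9 _∘_
  field
    Obj       : Set o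
    _⇒_       : Obj → Obj → Set h
    _≈_       : ∀ {X Y} → X ⇒ Y → X ⇒ Y → Set e
    id        : ∀ {X} → X ⇒ X
    _∘_       : ∀ {X Y Z} → Y ⇒ Z → X ⇒ Y → X ⇒ Z
    equiv     : ∀ {X Y} → IsEquivalence (_≈_ {X} {Y})
    ∘-resp-≈  : ∀ {X Y Z} {f f′ : Y ⇒ Z} {g g′ : X ⇒ Y} → f ≈ f′ → g ≈ g′ → f ∘ g ≈ f′ ∘ g′
    assoc     : ∀ {W X Y Z} {f : W ⇒ X} {g : X ⇒ Y} {h : Y ⇒ Z} → (h ∘ g) ∘ f ≈ h ∘ (g ∘ f)
    identityˡ : ∀ {X Y} {f : X ⇒ Y} → id ∘ f ≈ f
    identityʳ : ∀ {X Y} {f : X ⇒ Y} → f ∘ id ≈ f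

  hom-setoid : Obj → Obj → Setoid h e
  hom-setoid X Y = record { isEquivalence = equiv {X} {Y} }

  module _ {X Y : Obj} where
    open IsEquivalence (equiv {X} {Y}) public
      renaming (refl to ≈-refl; sym to ≈-sym; trans to ≈-trans) using ()


module _ {o h e : Level} (C : Category o h e) where
  open Category C

  Mono : ∀ {X Y} → X ⇒ Y → Set (o ⊔ h ⊔ e)
  Mono {X} m = ∀ {T} {f g : T ⇒ X} → m ∘ f ≈ m ∘ g → f ≈ g

  IsIso : ∀ {X Y} → X ⇒ Y → Set (h ⊔ e)
  IsIso {X} {Y} f = Σ[ g ∈ Y ⇒ X ] (f ∘ g ≈ id) × (g ∘ f ≈ id)

  -- Extremal epimorphisms; in a regular category, exactly the regular ones.
  Cover : ∀ {X Y} → X ⇒ Y → Set (o ⊔ h ⊔ e)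
  Cover {X} {Y} f = ∀ {U} (m : U ⇒ Y) (g : X ⇒ U) → Mono m → m ∘ g ≈ f → IsIso m

  record IsTerminal (T : Obj) : Set (o ⊔ h ⊔ e) where
    field
      !        : ∀ {X} → X ⇒ T
      !-unique : ∀ {X} (f g : X ⇒ T) → f ≈ g

  record IsPullback {P X Y Z} (p₁ : P ⇒ X) (p₂ : P ⇒ Y) (f : X ⇒ Z) (g : Y ⇒ Z)
         : Set (o ⊔ h ⊔ e) where
    field
      commute   : f ∘ p₁ ≈ g ∘ p₂
      universal : ∀ {T} {h₁ : T ⇒ X} {h₂ : T ⇒ Y} → f ∘ h₁ ≈ g ∘ h₂ → T ⇒ P
      p₁∘univ   : ∀ {T} {h₁ : T ⇒ X} {h₂ : T ⇒ Y} (eq : f ∘ h₁ ≈ g ∘ h₂) → p₁ ∘ universal eq ≈ h₁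
      p₂∘univ   : ∀ {T} {h₁ : T ⇒ X} {h₂ : T ⇒ Y} (eq : f ∘ h₁ ≈ g ∘ h₂) → p₂ ∘ universal eq ≈ h₂
      joint     : ∀ {T} {u v : T ⇒ P} → p₁ ∘ u ≈ p₁ ∘ v → p₂ ∘ u ≈ p₂ ∘ v → u ≈ v

module CategoryLemmas {o h e : Level} (C : Category o h e) where
  open Category C

  module HomReasoning {X Y : Obj} = SetoidReasoning (hom-setoid X Y)

  infixr 4 _⟩∘_ _∘⟨_
  _⟩∘_ : ∀ {X Y Z} {f f′ : Y ⇒ Z} → f ≈ f′ → (g : X ⇒ Y) → f ∘ g ≈ f′ ∘ g
  p ⟩∘ g = ∘-resp-≈ p ≈-refl

  _∘⟨_ : ∀ {X Y Z} (f : Y ⇒ Z) {g g′ : X ⇒ Y} → g ≈ g′ → f ∘ g ≈ f ∘ g′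
  f ∘⟨ p = ∘-resp-≈ ≈-refl p

  -- from p : a ∘ b ≈ c, the composites with a further map on the right
  pullˡ : ∀ {W X Y Z} {a : Y ⇒ Z} {b : X ⇒ Y} {c : X ⇒ Z} {f : W ⇒ X} →
          a ∘ b ≈ c → a ∘ (b ∘ f) ≈ c ∘ f
  pullˡ p = ≈-trans (≈-sym assoc) (p ⟩∘ _)

  id-cover : ∀ {X} → Cover C (id {X})
  id-cover m g mono eq = g , eq , mono (begin
    m ∘ (g ∘ m)  ≈⟨ pullˡ eq ⟩
    id ∘ m       ≈⟨ identityˡ ⟩
    m            ≈⟨ identityʳ ⟨
    m ∘ id       ∎)
    where open HomReasoning

  cover-resp : ∀ {X Y} {f g : X ⇒ Y} → f ≈ g → Cover C f → Cover C g
  cover-resp eq c m h mono p = c m h mono (≈-trans p (≈-sym eq))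

  cover-cancel : ∀ {X Y Z} {f : Y ⇒ Z} {g : X ⇒ Y} → Cover C (f ∘ g) → Cover C f
  cover-cancel {g = g} c m h mono eq = c m (h ∘ g) mono (pullˡ eq)

  -- Two pullbacks of one cospan have isomorphic apices.
  pullback-transport : ∀ {P Q X Y Z} {p₁ : P ⇒ X} {p₂ : P ⇒ Y} {q₁ : Q ⇒ X} {q₂ : Q ⇒ Y}
    {f : X ⇒ Z} {g : Y ⇒ Z} → IsPullback C p₁ p₂ f g → IsPullback C q₁ q₂ f g →
    Σ[ i ∈ P ⇒ Q ] Σ[ j ∈ Q ⇒ P ] (j ∘ i ≈ id) ×
      ((q₁ ∘ i ≈ p₁) × (q₂ ∘ i ≈ p₂)) × ((p₁ ∘ j ≈ q₁) × (p₂ ∘ j ≈ q₂))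
  pullback-transport isP isQ =
      Q.universal P.commute , P.universal Q.commute
    , P.joint (≈-trans (pullˡ (P.p₁∘univ Q.commute)) (≈-trans (Q.p₁∘univ P.commute) (≈-sym identityʳ)))
              (≈-trans (pullˡ (P.p₂∘univ Q.commute)) (≈-trans (Q.p₂∘univ P.commute) (≈-sym identityʳ)))
    , (Q.p₁∘univ P.commute , Q.p₂∘univ P.commute)
    , (P.p₁∘univ Q.commute , P.p₂∘univ Q.commute)
    where
      module P = IsPullback isP
      module Q = IsPullback isQ

record Functor {o h e o′ h′ e′ : Level} (C : Category o h e) (D : Category o′ h′ e′)
       : Set (o ⊔ h ⊔ e ⊔ o′ ⊔ h′ ⊔ e′) where
  private
    module C = Category C
    module D = Category D
  field
    F₀       : C.Obj → D.Obj
    F₁       : ∀ {X Y} → X C.⇒ Y → F₀ X D.⇒ F₀ Y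
    F-resp-≈ : ∀ {X Y} {f g : X C.⇒ Y} → f C.≈ g → F₁ f D.≈ F₁ g
    identity : ∀ {X} → F₁ (C.id {X}) D.≈ D.id
    homomorphism : ∀ {X Y Z} {f : X C.⇒ Y} {g : Y C.⇒ Z} → F₁ (g C.∘ f) D.≈ F₁ g D.∘ F₁ f

  resp-triangle : ∀ {X Y Z} {f : X C.⇒ Y} {g : Y C.⇒ Z} {h : X C.⇒ Z} →
                  g C.∘ f C.≈ h → F₁ g D.∘ F₁ f D.≈ F₁ h
  resp-triangle eq = D.≈-trans (D.≈-sym homomorphism) (F-resp-≈ eq)

  Full : Set (o ⊔ h ⊔ h′ ⊔ e′)
  Full = ∀ {X Y} (g : F₀ X D.⇒ F₀ Y) → Σ[ f ∈ X C.⇒ Y ] F₁ f D.≈ g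

  Faithful : Set (o ⊔ h ⊔ e ⊔ e′)
  Faithful = ∀ {X Y} {f g : X C.⇒ Y} → F₁ f D.≈ F₁ g → f C.≈ g

  -- Preservation of terminal objects and pullbacks, i.e. of finite limits.
  record LeftExact : Set (o ⊔ h ⊔ e ⊔ o′ ⊔ h′ ⊔ e′) where
    field
      terminal : ∀ {T} → IsTerminal C T → IsTerminal D (F₀ T)
      pullback : ∀ {P X Y Z} {p₁ : P C.⇒ X} {p₂ : P C.⇒ Y} {f : X C.⇒ Z} {g : Y C.⇒ Z} →
                 IsPullback C p₁ p₂ f g → IsPullback D (F₁ p₁) (F₁ p₂) (F₁ f) (F₁ g)

  record IsRegularFunctor : Set (o ⊔ h ⊔ e ⊔ o′ ⊔ h′ ⊔ e′) where
    field
      leftExact : LeftExact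
      cover     : ∀ {X Y} {f : X C.⇒ Y} → Cover C f → Cover D (F₁ f)

    open LeftExact leftExact public

record NaturalIsomorphism {o h e o′ h′ e′ : Level} {C : Category o h e} {D : Category o′ h′ e′}
       (F G : Functor C D) : Set (o ⊔ h ⊔ e ⊔ o′ ⊔ h′ ⊔ e′) where
  private
    module C = Category C
    module D = Category D
    module F = Functor F
    module G = Functor G
  field
    η       : ∀ X → F.F₀ X D.⇒ G.F₀ X
    natural : ∀ {X Y} (f : X C.⇒ Y) → η Y D.∘ F.F₁ f D.≈ G.F₁ f D.∘ η X
    iso     : ∀ X → IsIso D (η X)

record _⊣_ {o h e o′ h′ e′ : Level} {C : Category o h e} {D : Category o′ h′ e′}
       (L : Functor C D) (R : Functor D C) : Set (o ⊔ h ⊔ e ⊔ o′ ⊔ h′ ⊔ e′) where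
  private
    module C = Category C
    module D = Category D
    module L = Functor L
    module R = Functor R
  field
    unit           : ∀ X → X C.⇒ R.F₀ (L.F₀ X)
    counit         : ∀ Y → L.F₀ (R.F₀ Y) D.⇒ Y
    unit-natural   : ∀ {X X′} (f : X C.⇒ X′) → unit X′ C.∘ f C.≈ R.F₁ (L.F₁ f) C.∘ unit X
    counit-natural : ∀ {Y Y′} (g : Y D.⇒ Y′) → counit Y′ D.∘ L.F₁ (R.F₁ g) D.≈ g D.∘ counit Y
    zig            : ∀ X → counit (L.F₀ X) D.∘ L.F₁ (unit X) D.≈ D.id
    zag            : ∀ Y → R.F₁ (counit Y) C.∘ unit (R.F₀ Y) C.≈ C.id

-- A geometric morphism E → F; it is an inclusion when its direct image is full and faithful.
record GeometricMorphism {o h e o′ h′ e′ : Level} (E : Category o h e) (F : Category o′ h′ e′)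
       : Set (o ⊔ h ⊔ e ⊔ o′ ⊔ h′ ⊔ e′) where
  field
    inverseImage : Functor F E
    directImage  : Functor E F
    adjunction   : inverseImage ⊣ directImage
    leftExact    : Functor.LeftExact inverseImage

IsInclusion : ∀ {o h e o′ h′ e′ : Level} {E : Category o h e} {F : Category o′ h′ e′} →
              GeometricMorphism E F → Set (o ⊔ h ⊔ e ⊔ h′ ⊔ e′)
IsInclusion f = Functor.Full directImage × Functor.Faithful directImage
  where open GeometricMorphism f

------------------------------------------------------------------------
-- Regular categories and their exact completion

-- Finite limits (terminal object and pullbacks), and factorizations into a cover
-- followed by a mono, with covers stable under pullback.

record Regular {o h e : Level} (C : Category o h e) : Set (o ⊔ h ⊔ e) where
  open Category C
  field
    ⊤ᶜ          : Obj
    ⊤-terminal  : IsTerminal C ⊤ᶜ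
    Pb          : ∀ {X Y Z} → X ⇒ Z → Y ⇒ Z → Obj
    p₁          : ∀ {X Y Z} (f : X ⇒ Z) (g : Y ⇒ Z) → Pb f g ⇒ X
    p₂          : ∀ {X Y Z} (f : X ⇒ Z) (g : Y ⇒ Z) → Pb f g ⇒ Y
    Pb-pullback : ∀ {X Y Z} (f : X ⇒ Z) (g : Y ⇒ Z) → IsPullback C (p₁ f g) (p₂ f g) f g
    Im          : ∀ {X Y} → X ⇒ Y → Obj
    coim        : ∀ {X Y} (f : X ⇒ Y) → X ⇒ Im f
    im          : ∀ {X Y} (f : X ⇒ Y) → Im f ⇒ Y
    im∘coim     : ∀ {X Y} (f : X ⇒ Y) → im f ∘ coim f ≈ f
    coim-cover  : ∀ {X Y} (f : X ⇒ Y) → Cover C (coim f)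
    im-mono     : ∀ {X Y} (f : X ⇒ Y) → Mono C (im f)
    p₁-cover    : ∀ {X Y Z} (f : X ⇒ Z) (g : Y ⇒ Z) → Cover C g → Cover C (p₁ f g)

module Relations {o h e : Level} (C : Category o h e) where
  open Category C

  record Rel (X Y : Obj) : Set (o ⊔ h ⊔ e) where
    field
      apex  : Obj
      π₁    : apex ⇒ X
      π₂    : apex ⇒ Y
      joint : ∀ {T} {u v : T ⇒ apex} → π₁ ∘ u ≈ π₁ ∘ v → π₂ ∘ u ≈ π₂ ∘ v → u ≈ v

  -- R ∋⟨ x , y ⟩: the generalized element (x , y) of X × Y at stage T belongs to R.
  infix 4 _∋⟨_,_⟩ _⊑_
  _∋⟨_,_⟩ : ∀ {X Y T} → Rel X Y → T ⇒ X → T ⇒ Y → Set (h ⊔ e)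
  R ∋⟨ x , y ⟩ = ∃ λ t → (π₁ ∘ t ≈ x) × (π₂ ∘ t ≈ y)
    where open Rel R

  _⊑_ : ∀ {X Y} → Rel X Y → Rel X Y → Set (h ⊔ e)
  R ⊑ S = S ∋⟨ Rel.π₁ R , Rel.π₂ R ⟩

  -- Each T ⇒ apex is an equivalence relation on the maps T ⇒ X.
  record IsEquivalenceRelation {X : Obj} (R : Rel X X) : Set (o ⊔ h ⊔ e) where
    field
      reflexive  : ∀ {T} {x : T ⇒ X} → R ∋⟨ x , x ⟩
      symmetric  : ∀ {T} {x y : T ⇒ X} → R ∋⟨ x , y ⟩ → R ∋⟨ y , x ⟩
      transitive : ∀ {T} {x y z : T ⇒ X} → R ∋⟨ x , y ⟩ → R ∋⟨ y , z ⟩ → R ∋⟨ x , z ⟩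

  -- The formal quotient of base by eqv.
  record Quotient : Set (o ⊔ h ⊔ e) where
    field
      base     : Obj
      eqv      : Rel base base
      isEquiv  : IsEquivalenceRelation eqv

    open IsEquivalenceRelation isEquiv public

  record FunctionalRelation (X Y : Quotient) : Set (o ⊔ h ⊔ e) where
    private
      module X = Quotient X
      module Y = Quotient Y
    field
      graph       : Rel X.base Y.base
      saturated   : ∀ {T} {x x′ : T ⇒ X.base} {y y′ : T ⇒ Y.base} →
                    X.eqv ∋⟨ x′ , x ⟩ → graph ∋⟨ x , y ⟩ → Y.eqv ∋⟨ y , y′ ⟩ → graph ∋⟨ x′ , y′ ⟩
      singleValued : ∀ {T} {x : T ⇒ X.base} {y y′ : T ⇒ Y.base} →
                    graph ∋⟨ x , y ⟩ → graph ∋⟨ x , y′ ⟩ → Y.eqv ∋⟨ y , y′ ⟩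
      total       : Cover C (Rel.π₁ graph)

module RegularLemmas {o h e : Level} {C : Category o h e} (reg : Regular C) where
  open Category C
  open CategoryLemmas C
  open Relations C
  open Regular reg

  module ⊤ᶜ = IsTerminal ⊤-terminal
  module Pb {X Y Z} (f : X ⇒ Z) (g : Y ⇒ Z) = IsPullback (Pb-pullback f g)

  _×ᶜ_ : Obj → Obj → Obj
  X ×ᶜ Y = Pb (⊤ᶜ.! {X}) (⊤ᶜ.! {Y})

  fstᶜ : ∀ {X Y} → X ×ᶜ Y ⇒ X
  fstᶜ = p₁ ⊤ᶜ.! ⊤ᶜ.!

  sndᶜ : ∀ {X Y} → X ×ᶜ Y ⇒ Y
  sndᶜ = p₂ ⊤ᶜ.! ⊤ᶜ.!

  ⟨_,_⟩ : ∀ {T X Y} → T ⇒ X → T ⇒ Y → T ⇒ X ×ᶜ Y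
  ⟨ x , y ⟩ = Pb.universal _ _ {h₁ = x} {h₂ = y} (⊤ᶜ.!-unique _ _)

  fst-β : ∀ {T X Y} {x : T ⇒ X} {y : T ⇒ Y} → fstᶜ ∘ ⟨ x , y ⟩ ≈ x
  fst-β = Pb.p₁∘univ _ _ _

  snd-β : ∀ {T X Y} {x : T ⇒ X} {y : T ⇒ Y} → sndᶜ ∘ ⟨ x , y ⟩ ≈ y
  snd-β = Pb.p₂∘univ _ _ _

  ⟨⟩-ext : ∀ {T X Y} {u v : T ⇒ X ×ᶜ Y} → fstᶜ ∘ u ≈ fstᶜ ∘ v → sndᶜ ∘ u ≈ sndᶜ ∘ v → u ≈ v
  ⟨⟩-ext = Pb.joint _ _

  -- If e is a cover and x ∘ e factors through a mono, so does x.
  lift-cover : ∀ {T′ T U Y} {e : T′ ⇒ T} {m : U ⇒ Y} {x : T ⇒ Y} (u : T′ ⇒ U) →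
               Cover C e → Mono C m → m ∘ u ≈ x ∘ e → Σ[ v ∈ T ⇒ U ] m ∘ v ≈ x
  lift-cover {e = e} {m} {x} u c mono eq = p₂ x m ∘ i , (begin
      m ∘ (p₂ x m ∘ i)  ≈⟨ assoc ⟨
      (m ∘ p₂ x m) ∘ i  ≈⟨ Pb.commute x m ⟩∘ i ⟨
      (x ∘ p₁ x m) ∘ i  ≈⟨ assoc ⟩
      x ∘ (p₁ x m ∘ i)  ≈⟨ x ∘⟨ proj₁ (proj₂ p₁-iso) ⟩
      x ∘ id            ≈⟨ identityʳ ⟩
      x                 ∎)
    where
      open HomReasoning
      p₁-mono : Mono C (p₁ x m)
      p₁-mono {f = f} {g} p = Pb.joint x m p (mono (begin
        m ∘ (p₂ x m ∘ f)  ≈⟨ pullˡ (≈-sym (Pb.commute x m)) ⟩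
        (x ∘ p₁ x m) ∘ f  ≈⟨ assoc ⟩
        x ∘ (p₁ x m ∘ f)  ≈⟨ x ∘⟨ p ⟩
        x ∘ (p₁ x m ∘ g)  ≈⟨ assoc ⟨
        (x ∘ p₁ x m) ∘ g  ≈⟨ pullˡ (≈-sym (Pb.commute x m)) ⟨
        m ∘ (p₂ x m ∘ g)  ∎))
      p₁-iso : IsIso C (p₁ x m)
      p₁-iso = c (p₁ x m) (Pb.universal x m {h₁ = e} {h₂ = u} (≈-sym eq)) p₁-mono (Pb.p₁∘univ x m _)
      i = proj₁ p₁-iso

  cover-∘ : ∀ {X Y Z} {f : Y ⇒ Z} {g : X ⇒ Y} → Cover C f → Cover C g → Cover C (f ∘ g)
  cover-∘ cf cg m h mono eq with lift-cover h cg mono eq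
  ... | v , p = cf m v mono p

  infixr 9 _⨾_
  _⨾_ : ∀ {X Y Z} → Rel X Y → Rel Y Z → Rel X Z
  R ⨾ S = record
    { apex  = Im f
    ; π₁    = fstᶜ ∘ im f
    ; π₂    = sndᶜ ∘ im f
    ; joint = λ p q → im-mono f (⟨⟩-ext (≈-trans (≈-sym assoc) (≈-trans p assoc))
                                        (≈-trans (≈-sym assoc) (≈-trans q assoc)))
    }
    where
      module R = Rel R
      module S = Rel S
      f = ⟨ R.π₁ ∘ p₁ R.π₂ S.π₁ , S.π₂ ∘ p₂ R.π₂ S.π₁ ⟩

  ∋-resp : ∀ {X Y T} (R : Rel X Y) {x x′ : T ⇒ X} {y y′ : T ⇒ Y} →
           x ≈ x′ → y ≈ y′ → R ∋⟨ x , y ⟩ → R ∋⟨ x′ , y′ ⟩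
  ∋-resp R p q (t , a , b) = t , ≈-trans a p , ≈-trans b q

  ∋-restrict : ∀ {X Y T T′} (R : Rel X Y) {x : T ⇒ X} {y : T ⇒ Y} (e : T′ ⇒ T) →
               R ∋⟨ x , y ⟩ → R ∋⟨ x ∘ e , y ∘ e ⟩
  ∋-restrict R e (t , a , b) = t ∘ e , pullˡ a , pullˡ b

  ⊑-apply : ∀ {X Y T} (R S : Rel X Y) {x : T ⇒ X} {y : T ⇒ Y} →
            R ⊑ S → R ∋⟨ x , y ⟩ → S ∋⟨ x , y ⟩
  ⊑-apply R S le (t , a , b) = ∋-resp S a b (∋-restrict S t le)

  generic : ∀ {X Y} (R : Rel X Y) → R ∋⟨ Rel.π₁ R , Rel.π₂ R ⟩
  generic R = id , identityʳ , identityʳ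

  ∋-descend : ∀ {X Y T T′} (R : Rel X Y) {x : T ⇒ X} {y : T ⇒ Y} {e : T′ ⇒ T} →
              Cover C e → R ∋⟨ x ∘ e , y ∘ e ⟩ → R ∋⟨ x , y ⟩
  ∋-descend R {x} {y} {e} c (t , a , b) with lift-cover {m = ⟨ R.π₁ , R.π₂ ⟩} {x = ⟨ x , y ⟩} t c
    (λ p → R.joint (≈-trans (≈-sym (pullˡ fst-β)) (≈-trans (fstᶜ ∘⟨ p) (pullˡ fst-β)))
                   (≈-trans (≈-sym (pullˡ snd-β)) (≈-trans (sndᶜ ∘⟨ p) (pullˡ snd-β))))
    (⟨⟩-ext (≈-trans (pullˡ fst-β) (≈-trans a (≈-sym (pullˡ fst-β))))
            (≈-trans (pullˡ snd-β) (≈-trans b (≈-sym (pullˡ snd-β)))))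
    where module R = Rel R
  ... | v , p = v , ≈-trans (≈-sym (pullˡ fst-β)) (≈-trans (fstᶜ ∘⟨ p) fst-β)
                  , ≈-trans (≈-sym (pullˡ snd-β)) (≈-trans (sndᶜ ∘⟨ p) snd-β)

  ⨾-intro : ∀ {X Y Z T} (R : Rel X Y) (S : Rel Y Z) {x : T ⇒ X} {y : T ⇒ Y} {z : T ⇒ Z} →
            R ∋⟨ x , y ⟩ → S ∋⟨ y , z ⟩ → R ⨾ S ∋⟨ x , z ⟩
  ⨾-intro R S (r , a , b) (s , c , d) = coim f ∘ w
      , ≈-trans assoc (≈-trans (fstᶜ ∘⟨ pullˡ (im∘coim f)) (≈-trans (pullˡ fst-β)
          (≈-trans assoc (≈-trans (R.π₁ ∘⟨ P.p₁∘univ eq) a))))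
      , ≈-trans assoc (≈-trans (sndᶜ ∘⟨ pullˡ (im∘coim f)) (≈-trans (pullˡ snd-β)
          (≈-trans assoc (≈-trans (S.π₂ ∘⟨ P.p₂∘univ eq) d))))
    where
      module R = Rel R
      module S = Rel S
      module P = Pb R.π₂ S.π₁
      f = ⟨ R.π₁ ∘ p₁ R.π₂ S.π₁ , S.π₂ ∘ p₂ R.π₂ S.π₁ ⟩
      eq = ≈-trans b (≈-sym c)
      w = P.universal eq

  ⨾-elim : ∀ {X Y Z T} (R : Rel X Y) (S : Rel Y Z) {x : T ⇒ X} {z : T ⇒ Z} →
           R ⨾ S ∋⟨ x , z ⟩ →
           Σ[ T′ ∈ Obj ] Σ[ e ∈ T′ ⇒ T ] Cover C e ×
             Σ[ y ∈ T′ ⇒ Y ] (R ∋⟨ x ∘ e , y ⟩) × (S ∋⟨ y , z ∘ e ⟩)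
  ⨾-elim R S {x} {z} (t , a , b) =
      Pb t (coim f) , ε , p₁-cover t (coim f) (coim-cover f) , R.π₂ ∘ (p₁ R.π₂ S.π₁ ∘ u)
    , (p₁ R.π₂ S.π₁ ∘ u , ≈-trans (≈-sym assoc) (factor fstᶜ fst-β a) , ≈-refl)
    , (p₂ R.π₂ S.π₁ ∘ u , ≈-trans (≈-sym assoc) (≈-trans (≈-sym (Pb.commute R.π₂ S.π₁) ⟩∘ u) assoc)
                        , ≈-trans (≈-sym assoc) (factor sndᶜ snd-β b))
    where
      module R = Rel R
      module S = Rel S
      f = ⟨ R.π₁ ∘ p₁ R.π₂ S.π₁ , S.π₂ ∘ p₂ R.π₂ S.π₁ ⟩
      ε = p₁ t (coim f)
      u = p₂ t (coim f)
      factor : ∀ {W} {w : _ ⇒ W} (q : _ ⇒ W) {x : _ ⇒ W} →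
               q ∘ f ≈ w → (q ∘ im f) ∘ t ≈ x → w ∘ u ≈ x ∘ ε
      factor {w = w} q {x} p r = begin
        w ∘ u                        ≈⟨ p ⟩∘ u ⟨
        (q ∘ f) ∘ u                  ≈⟨ (q ∘⟨ im∘coim f) ⟩∘ u ⟨
        (q ∘ (im f ∘ coim f)) ∘ u    ≈⟨ ≈-trans (≈-sym assoc ⟩∘ u) assoc ⟩
        (q ∘ im f) ∘ (coim f ∘ u)    ≈⟨ (q ∘ im f) ∘⟨ Pb.commute t (coim f) ⟨
        (q ∘ im f) ∘ (t ∘ ε)         ≈⟨ pullˡ r ⟩
        x ∘ ε                        ∎
        where open HomReasoning

-- The ex/reg completion: formal quotients of equivalence relations, with functional
-- relations as morphisms.

module ExactCompletion {o h e : Level} {C : Category o h e} (reg : Regular C) where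
  open Category C
  open CategoryLemmas C
  open Relations C
  open Regular reg
  open RegularLemmas reg
  open FunctionalRelation using (graph)

  infix 4 _≈ᶠ_
  _≈ᶠ_ : ∀ {X Y} → FunctionalRelation X Y → FunctionalRelation X Y → Set (h ⊔ e)
  F ≈ᶠ G = (graph F ⊑ graph G) × (graph G ⊑ graph F)

  total-intro : ∀ {X Y T} (R : Rel X Y) {x : T ⇒ X} {y : T ⇒ Y} →
                Cover C x → R ∋⟨ x , y ⟩ → Cover C (Rel.π₁ R)
  total-intro R c (t , a , _) = cover-cancel (cover-resp (≈-sym a) c)

  idᶠ : ∀ {X} → FunctionalRelation X X
  idᶠ {X} = record
    { graph        = X.eqv
    ; saturated    = λ p q r → X.transitive p (X.transitive q r)
    ; singleValued = λ p q → X.transitive (X.symmetric p) q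
    ; total        = total-intro X.eqv id-cover X.reflexive
    }
    where module X = Quotient X

  infixr 9 _∘ᶠ_
  _∘ᶠ_ : ∀ {X Y Z} → FunctionalRelation Y Z → FunctionalRelation X Y → FunctionalRelation X Z
  _∘ᶠ_ {X} {Y} {Z} G F = record
    { graph        = F.graph ⨾ G.graph
    ; saturated    = λ p q r →
        let (_ , e , c , y , a , b) = ⨾-elim F.graph G.graph q in
        ∋-descend (F.graph ⨾ G.graph) c (⨾-intro F.graph G.graph
          (F.saturated (∋-restrict X.eqv e p) a Y.reflexive)
          (G.saturated Y.reflexive b (∋-restrict Z.eqv e r)))
    ; singleValued = λ p q →
        let (_ , e , c , y , a , b) = ⨾-elim F.graph G.graph p
            (_ , e′ , c′ , y′ , a′ , b′) = ⨾-elim F.graph G.graph (∋-restrict (F.graph ⨾ G.graph) e q)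
            yy′ = F.singleValued (∋-restrict F.graph e′ a) a′
        in ∋-descend Z.eqv c (∋-descend Z.eqv c′
             (G.singleValued (∋-restrict G.graph e′ b) (G.saturated yy′ b′ Z.reflexive)))
    ; total        =
        let f = Rel.π₂ F.graph
            g = Rel.π₁ G.graph
        in total-intro (F.graph ⨾ G.graph) (cover-∘ F.total (p₁-cover f g G.total))
             (⨾-intro F.graph G.graph
               (∋-restrict F.graph (p₁ f g) (generic F.graph))
               (∋-resp G.graph (≈-sym (Pb.commute f g)) ≈-refl
                 (∋-restrict G.graph (p₂ f g) (generic G.graph))))
    }
    where
      module X = Quotient X
      module Y = Quotient Y
      module Z = Quotient Z
      module F = FunctionalRelation F
      module G = FunctionalRelation G

  private
    ⨾-mono : ∀ {X Y Z} (R R′ : Rel X Y) (S S′ : Rel Y Z) → R ⊑ R′ → S ⊑ S′ → R ⨾ S ⊑ R′ ⨾ S′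
    ⨾-mono R R′ S S′ p q =
      let (_ , e , c , y , a , b) = ⨾-elim R S (generic (R ⨾ S)) in
      ∋-descend (R′ ⨾ S′) c (⨾-intro R′ S′ (⊑-apply R R′ p a) (⊑-apply S S′ q b))

    ⨾-assoc₁ : ∀ {W X Y Z} (R : Rel W X) (S : Rel X Y) (U : Rel Y Z) →
               R ⨾ (S ⨾ U) ⊑ (R ⨾ S) ⨾ U
    ⨾-assoc₁ R S U =
      let (_ , e , c , x , a , b) = ⨾-elim R (S ⨾ U) (generic (R ⨾ (S ⨾ U)))
          (_ , e′ , c′ , y , a′ , b′) = ⨾-elim S U b
      in ∋-descend ((R ⨾ S) ⨾ U) c (∋-descend ((R ⨾ S) ⨾ U) c′
           (⨾-intro (R ⨾ S) U (⨾-intro R S (∋-restrict R e′ a) a′) b′))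

    ⨾-assoc₂ : ∀ {W X Y Z} (R : Rel W X) (S : Rel X Y) (U : Rel Y Z) →
               (R ⨾ S) ⨾ U ⊑ R ⨾ (S ⨾ U)
    ⨾-assoc₂ R S U =
      let (_ , e , c , y , a , b) = ⨾-elim (R ⨾ S) U (generic ((R ⨾ S) ⨾ U))
          (_ , e′ , c′ , x , a′ , b′) = ⨾-elim R S a
      in ∋-descend (R ⨾ (S ⨾ U)) c (∋-descend (R ⨾ (S ⨾ U)) c′
           (⨾-intro R (S ⨾ U) a′ (⨾-intro S U b′ (∋-restrict U e′ b))))

  ExReg : Category (o ⊔ h ⊔ e) (o ⊔ h ⊔ e) (h ⊔ e)
  ExReg = record
    { Obj       = Quotient
    ; _⇒_       = FunctionalRelation
    ; _≈_       = _≈ᶠ_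
    ; id        = idᶠ
    ; _∘_       = _∘ᶠ_
    ; equiv     = record
      { refl  = λ {F} → generic (graph F) , generic (graph F)
      ; sym   = λ (p , q) → q , p
      ; trans = λ {F} {G} {H} (p , q) (p′ , q′) →
          ⊑-apply (graph G) (graph H) p′ p , ⊑-apply (graph G) (graph F) q q′
      }
    ; ∘-resp-≈  = λ {_} {_} {_} {F} {F′} {G} {G′} (p , p′) (q , q′) →
        ⨾-mono (graph G) (graph G′) (graph F) (graph F′) q p ,
        ⨾-mono (graph G′) (graph G) (graph F′) (graph F) q′ p′
    ; assoc     = λ {_} {_} {_} {_} {F} {G} {H} →
        ⨾-assoc₁ (graph F) (graph G) (graph H) , ⨾-assoc₂ (graph F) (graph G) (graph H)
    ; identityˡ = λ {X} {Y} {F} →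
        (let (_ , e , c , y , a , b) = ⨾-elim (graph F) (Quotient.eqv Y) (generic (graph F ⨾ Quotient.eqv Y))
         in ∋-descend (graph F) c (FunctionalRelation.saturated F (Quotient.reflexive X) a b))
      , ⨾-intro (graph F) (Quotient.eqv Y) (generic (graph F)) (Quotient.reflexive Y)
    ; identityʳ = λ {X} {Y} {F} →
        (let (_ , e , c , y , a , b) = ⨾-elim (Quotient.eqv X) (graph F) (generic (Quotient.eqv X ⨾ graph F))
         in ∋-descend (graph F) c (FunctionalRelation.saturated F a b (Quotient.reflexive Y)))
      , ⨾-intro (Quotient.eqv X) (graph F) (Quotient.reflexive X) (generic (graph F))
    }

-- The extension of a regular functor to the exact completions: it is applied to
-- the equivalence relations and to the functional relations.

module RegularExtension {o h e o′ h′ e′ : Level} {C : Category o h e} {D : Category o′ h′ e′}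
       (regC : Regular C) (regD : Regular D) (F : Functor C D)
       (isReg : Functor.IsRegularFunctor F) where
  private
    module C where
      open Category C public
      open CategoryLemmas C public
      open Relations C public
      open Regular regC public
      open RegularLemmas regC public
    module D where
      open Category D public
      open CategoryLemmas D public
      open Relations D public
      open RegularLemmas regD public
  open Functor F
  open Functor.IsRegularFunctor isReg
  open C using (Rel; Quotient; FunctionalRelation; IsEquivalenceRelation)
  open ExactCompletion using (ExReg)

  preserves-mono : ∀ {X Y} {m : X C.⇒ Y} → Mono C m → Mono D (F₁ m)
  preserves-mono {m = m} mono {f = f} {g} eq = begin
    f                          ≈⟨ K.p₁∘univ eq ⟨
    F₁ C.id D.∘ K.universal eq ≈⟨ K.p₂∘univ eq ⟩
    g                          ∎
    where
      open D.HomReasoning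
      kernel : IsPullback C C.id C.id m m
      kernel = record
        { commute   = C.≈-refl
        ; universal = λ {_} {h₁} _ → h₁
        ; p₁∘univ   = λ _ → C.identityˡ
        ; p₂∘univ   = λ eq → C.≈-trans C.identityˡ (mono eq)
        ; joint     = λ p _ → C.≈-trans (C.≈-sym C.identityˡ) (C.≈-trans p C.identityˡ)
        }
      module K = IsPullback (pullback kernel)

  mapRel : ∀ {X Y} → Rel X Y → D.Rel (F₀ X) (F₀ Y)
  mapRel {X} {Y} R = record
    { apex  = F₀ R.apex
    ; π₁    = F₁ R.π₁
    ; π₂    = F₁ R.π₂
    ; joint = λ {_} {u} {v} p q → preserves-mono R-mono (IsPullback.joint product
        (D.≈-trans (D.pullˡ (resp-triangle C.fst-β))
          (D.≈-trans p (D.≈-sym (D.pullˡ (resp-triangle C.fst-β)))))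
        (D.≈-trans (D.pullˡ (resp-triangle C.snd-β))
          (D.≈-trans q (D.≈-sym (D.pullˡ (resp-triangle C.snd-β))))))
    }
    where
      module R = Rel R
      R-mono : Mono C C.⟨ R.π₁ , R.π₂ ⟩
      R-mono p = R.joint
        (C.≈-trans (C.≈-sym (C.pullˡ C.fst-β)) (C.≈-trans (C.fstᶜ C.∘⟨ p) (C.pullˡ C.fst-β)))
        (C.≈-trans (C.≈-sym (C.pullˡ C.snd-β)) (C.≈-trans (C.sndᶜ C.∘⟨ p) (C.pullˡ C.snd-β)))
      product = pullback (C.Pb-pullback (C.⊤ᶜ.! {X}) (C.⊤ᶜ.! {Y}))

  map-∋ : ∀ {X Y T} (R : Rel X Y) {x : T C.⇒ X} {y : T C.⇒ Y} →
          R C.∋⟨ x , y ⟩ → mapRel R D.∋⟨ F₁ x , F₁ y ⟩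
  map-∋ R (t , a , b) = F₁ t , resp-triangle a , resp-triangle b

  private
    _° : ∀ {X Y} → Rel X Y → Rel Y X
    R ° = record { apex = apex ; π₁ = π₂ ; π₂ = π₁ ; joint = λ p q → joint q p }
      where open Rel R

  map-compose : ∀ {X Y Z} (R : Rel X Y) (S : Rel Y Z) (U : Rel X Z) →
    (∀ {T} {x : T C.⇒ X} {y : T C.⇒ Y} {z : T C.⇒ Z} →
       R C.∋⟨ x , y ⟩ → S C.∋⟨ y , z ⟩ → U C.∋⟨ x , z ⟩) →
    ∀ {T} {x : T D.⇒ F₀ X} {y : T D.⇒ F₀ Y} {z : T D.⇒ F₀ Z} →
      mapRel R D.∋⟨ x , y ⟩ → mapRel S D.∋⟨ y , z ⟩ → mapRel U D.∋⟨ x , z ⟩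
  map-compose R S U comp (r , a , b) (s , c , d) =
    D.∋-resp (mapRel U)
      (D.≈-trans (homomorphism D.⟩∘ w)
        (D.≈-trans D.assoc (D.≈-trans (F₁ R.π₁ D.∘⟨ P.p₁∘univ eq) a)))
      (D.≈-trans (homomorphism D.⟩∘ w)
        (D.≈-trans D.assoc (D.≈-trans (F₁ S.π₂ D.∘⟨ P.p₂∘univ eq) d)))
      (D.∋-restrict (mapRel U) w (map-∋ U (comp
        (C.∋-restrict R p (C.generic R))
        (C.∋-resp S (C.≈-sym (C.Pb.commute R.π₂ S.π₁)) C.≈-refl (C.∋-restrict S q (C.generic S))))))
    where
      module R = Rel R
      module S = Rel S
      p = C.p₁ R.π₂ S.π₁
      q = C.p₂ R.π₂ S.π₁
      module P = IsPullback (pullback (C.Pb-pullback R.π₂ S.π₁))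
      eq = D.≈-trans b (D.≈-sym c)
      w = P.universal eq

  mapQuotient : Quotient → D.Quotient
  mapQuotient X = record
    { base    = F₀ X.base
    ; eqv     = mapRel X.eqv
    ; isEquiv = record
      { reflexive  = λ {_} {x} → D.∋-resp (mapRel X.eqv)
          (D.≈-trans (identity D.⟩∘ x) D.identityˡ) (D.≈-trans (identity D.⟩∘ x) D.identityˡ)
          (D.∋-restrict (mapRel X.eqv) x (map-∋ X.eqv X.reflexive))
      ; symmetric  = λ (t , a , b) → D.∋-resp (mapRel X.eqv) b a
          (D.∋-restrict (mapRel X.eqv) t (map-∋ X.eqv (X.symmetric (C.generic X.eqv))))
      ; transitive = map-compose X.eqv X.eqv X.eqv X.transitive
      }
    }
    where module X = Quotient X

  mapFunctional : ∀ {X Y} → FunctionalRelation X Y →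
                  D.FunctionalRelation (mapQuotient X) (mapQuotient Y)
  mapFunctional {X} {Y} G = record
    { graph        = mapRel graph
    ; saturated    = λ p q r →
        map-compose graph Y.eqv graph (saturated X.reflexive)
          (map-compose X.eqv graph graph (λ a b → saturated a b Y.reflexive) p q) r
    ; singleValued = λ (t , a , b) q →
        map-compose (graph °) graph Y.eqv (λ (t , a , b) q → singleValued (t , b , a) q) (t , b , a) q
    ; total        = cover total
    }
    where
      module X = Quotient X
      module Y = Quotient Y
      open FunctionalRelation G

  private
    map-⨾₁ : ∀ {X Y Z} (R : Rel X Y) (S : Rel Y Z) →
             mapRel (R C.⨾ S) D.⊑ mapRel R D.⨾ mapRel S
    map-⨾₁ R S =
      let (_ , ε , c , y , a , b) = C.⨾-elim R S (C.generic (R C.⨾ S)) in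
      D.∋-descend (mapRel R D.⨾ mapRel S) (cover c) (D.⨾-intro (mapRel R) (mapRel S)
        (D.∋-resp (mapRel R) homomorphism D.≈-refl (map-∋ R a))
        (D.∋-resp (mapRel S) D.≈-refl homomorphism (map-∋ S b)))

    map-⨾₂ : ∀ {X Y Z} (R : Rel X Y) (S : Rel Y Z) →
             mapRel R D.⨾ mapRel S D.⊑ mapRel (R C.⨾ S)
    map-⨾₂ R S =
      let (_ , ε , c , y , a , b) = D.⨾-elim (mapRel R) (mapRel S) (D.generic (mapRel R D.⨾ mapRel S)) in
      D.∋-descend (mapRel (R C.⨾ S)) c (map-compose R S (R C.⨾ S) (C.⨾-intro R S) a b)

  extension : Functor (ExReg regC) (ExReg regD)
  extension = record
    { F₀           = mapQuotient
    ; F₁           = mapFunctional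
    ; F-resp-≈     = λ {_} {_} {G} {H} (p , q) → map-∋ (graph H) p , map-∋ (graph G) q
    ; identity     = λ {X} → D.generic (mapRel (Quotient.eqv X)) , D.generic (mapRel (Quotient.eqv X))
    ; homomorphism = λ {_} {_} {_} {G} {H} → map-⨾₁ (graph G) (graph H) , map-⨾₂ (graph G) (graph H)
    }
    where open FunctionalRelation using (graph)

------------------------------------------------------------------------
-- Assemblies

module Assemblies {ℓ : Level} (A : PCA ℓ) where
  open PCA A using (_·_↦_)
  private
    module A = PCA A
    open Combinators A

  record Assembly : Set (lsuc ℓ) where
    field
      setoid     : Setoid ℓ ℓ
    open Setoid setoid public using (Carrier) renaming
      (_≈_ to _≈ˢ_; refl to reflˢ; sym to symˢ; trans to transˢ)
    field
      E          : Carrier → Pred A.Carrier ℓ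
      E-resp     : ∀ {x x′ a a′} → x ≈ˢ x′ → a A.≈ a′ → a ∈ E x → a′ ∈ E x′
      E-nonempty : ∀ x → Satisfiable (E x)

  record AssMorphism (X Y : Assembly) : Set ℓ where
    private
      module X = Assembly X
      module Y = Assembly Y
    field
      function : Func X.setoid Y.setoid
    open Func function public using (to; cong)
    field
      tracked  : Σ[ a ∈ A.Carrier ]
        (∀ {x b} → b ∈ X.E x → ∃ λ c → (a · b ↦ c) × (c ∈ Y.E (to x)))

  open Assembly using (Carrier; _≈ˢ_; reflˢ; symˢ; transˢ; E; E-resp; E-nonempty)
  open AssMorphism

  constant : ∀ {X Y : Assembly} → Carrier Y → AssMorphism X Y
  constant {X} {Y} y = record
    { function = record { to = λ _ → y ; cong = λ _ → reflˢ Y }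
    ; tracked  = let (a , p) = E-nonempty Y y in K a , λ _ → a , K-β , p
    }

  Ass : Category (lsuc ℓ) ℓ ℓ
  Ass = record
    { Obj       = Assembly
    ; _⇒_       = AssMorphism
    ; _≈_       = λ {X} {Y} f g → ∀ x → _≈ˢ_ Y (to f x) (to g x)
    ; id        = record
      { function = record { to = λ x → x ; cong = λ p → p }
      ; tracked  = I , λ p → _ , I-β , p
      }
    ; _∘_       = λ g f → record
      { function = record { to = λ x → to g (to f x) ; cong = λ p → cong g (cong f p) }
      ; tracked  = proj₁ (tracked g) ⋆ proj₁ (tracked f) , λ p →
          let (_ , q , r) = proj₂ (tracked f) p
              (_ , q′ , r′) = proj₂ (tracked g) r
          in _ , ⋆-β q q′ , r′
      }
    ; equiv     = λ {X} {Y} → record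
      { refl  = λ _ → reflˢ Y
      ; sym   = λ p x → symˢ Y (p x)
      ; trans = λ p q x → transˢ Y (p x) (q x)
      }
    ; ∘-resp-≈  = λ {_} {_} {Z} {_} {f′} {g} p q x → transˢ Z (p (to g x)) (cong f′ (q x))
    ; assoc     = λ {_} {_} {_} {Z} _ → reflˢ Z
    ; identityˡ = λ {_} {Y} _ → reflˢ Y
    ; identityʳ = λ {_} {Y} _ → reflˢ Y
    }

  open Category Ass using (_⇒_; _∘_)

  unitAss : Assembly
  unitAss = record
    { setoid     = record { Carrier = ⊤ ; _≈_ = λ _ _ → ⊤ }
    ; E          = λ _ _ → ⊤
    ; E-resp     = λ _ _ _ → tt
    ; E-nonempty = λ _ → A.k , tt
    }

  unit-terminal : IsTerminal Ass unitAss
  unit-terminal = record { ! = constant tt ; !-unique = λ _ _ _ → tt }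

  module _ {X Y Z : Assembly} (f : X ⇒ Z) (g : Y ⇒ Z) where
    pullbackAss : Assembly
    pullbackAss = record
      { setoid     = record
        { Carrier       = Σ[ x ∈ Carrier X ] Σ[ y ∈ Carrier Y ] _≈ˢ_ Z (to f x) (to g y)
        ; _≈_           = λ (x , y , _) (x′ , y′ , _) → _≈ˢ_ X x x′ × _≈ˢ_ Y y y′
        ; isEquivalence = record
          { refl  = reflˢ X , reflˢ Y
          ; sym   = λ (p , q) → symˢ X p , symˢ Y q
          ; trans = λ (p , q) (p′ , q′) → transˢ X p p′ , transˢ Y q q′
          }
        }
      ; E          = λ (x , y , _) c → (∃ λ a → (fst · c ↦ a) × (a ∈ E X x)) ×
                                       (∃ λ b → (snd · c ↦ b) × (b ∈ E Y y))
      ; E-resp     = λ (p , q) c≈ ((a , r , s) , (b , r′ , s′)) →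
          (a , A.↦-resp A.≈-refl c≈ A.≈-refl r , E-resp X p A.≈-refl s) ,
          (b , A.↦-resp A.≈-refl c≈ A.≈-refl r′ , E-resp Y q A.≈-refl s′)
      ; E-nonempty = λ (x , y , _) →
          let (a , p) = E-nonempty X x
              (b , q) = E-nonempty Y y
              (_ , c , _ , _ , r , s) = pair-β a b
          in c , (a , r , p) , (b , s , q)
      }

    proj-left : pullbackAss ⇒ X
    proj-left = record
      { function = record { to = proj₁ ; cong = proj₁ }
      ; tracked  = fst , λ (p , _) → p
      }

    proj-right : pullbackAss ⇒ Y
    proj-right = record
      { function = record { to = λ (_ , y , _) → y ; cong = proj₂ }
      ; tracked  = snd , λ (_ , q) → q
      }

    isPullbackAss : IsPullback Ass proj-left proj-right f g
    isPullbackAss = record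
      { commute   = λ (_ , _ , p) → p
      ; universal = λ {_} {h₁} {h₂} eq → record
        { function = record { to = λ t → to h₁ t , to h₂ t , eq t ; cong = λ p → cong h₁ p , cong h₂ p }
        ; tracked  = fun (both h₁ h₂) , λ p →
            let (a , q , r)   = proj₂ (tracked h₁) p
                (b , q′ , r′) = proj₂ (tracked h₂) p
                (_ , c , e , e′ , l , m) = pair-β a b
            in c , fun-β (both h₁ h₂) (⇓app (⇓app ⇓con-refl (⇓app ⇓con-refl ⇓var-refl q) e)
                                            (⇓app ⇓con-refl ⇓var-refl q′) e′)
                 , (a , l , r) , (b , m , r′)
        }
      ; p₁∘univ   = λ _ _ → reflˢ X
      ; p₂∘univ   = λ _ _ → reflˢ Y
      ; joint     = λ p q t → p t , q t
      }
      where
        open A using (⇓app)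
        both : ∀ {T} → T ⇒ X → T ⇒ Y → A.Term 1
        both h₁ h₂ = A.con pair A.∙ (A.con (proj₁ (tracked h₁)) A.∙ A.var zero)
                                A.∙ (A.con (proj₁ (tracked h₂)) A.∙ A.var zero)

  mono-injective : ∀ {X Y} {m : X ⇒ Y} → Mono Ass m →
                   ∀ {x x′} → _≈ˢ_ Y (to m x) (to m x′) → _≈ˢ_ X x x′
  mono-injective mono {x} {x′} p =
    mono {T = unitAss} {f = constant x} {g = constant x′} (λ _ → p) tt

  injective-mono : ∀ {X Y} (m : X ⇒ Y) →
                   (∀ {x x′} → _≈ˢ_ Y (to m x) (to m x′) → _≈ˢ_ X x x′) → Mono Ass m
  injective-mono m inj p t = inj (p t)

  -- Covers of assemblies are exactly the tracked surjections.
  TrackedSurjection : ∀ {X Y} → X ⇒ Y → Set ℓ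
  TrackedSurjection {X} {Y} f = Σ[ t ∈ A.Carrier ] (∀ {y b} → b ∈ E Y y →
    ∃₂ λ x a → (_≈ˢ_ Y (to f x) y) × (t · b ↦ a) × (a ∈ E X x))

  module _ {X Y : Assembly} (f : X ⇒ Y) where
    imageAss : Assembly
    imageAss = record
      { setoid     = record
        { Carrier       = Carrier X
        ; _≈_           = λ x x′ → _≈ˢ_ Y (to f x) (to f x′)
        ; isEquivalence = record { refl = reflˢ Y ; sym = symˢ Y ; trans = transˢ Y }
        }
      ; E          = λ x a → ∃ λ x′ → _≈ˢ_ Y (to f x′) (to f x) × (a ∈ E X x′)
      ; E-resp     = λ p a≈ (x , q , r) → x , transˢ Y q p , E-resp X (reflˢ X) a≈ r
      ; E-nonempty = λ x → let (a , p) = E-nonempty X x in a , x , reflˢ Y , p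
      }

    image-inclusion : imageAss ⇒ Y
    image-inclusion = record
      { function = record { to = to f ; cong = λ p → p }
      ; tracked  = proj₁ (tracked f) , λ (_ , p , q) →
          let (b , r , s) = proj₂ (tracked f) q in b , r , E-resp Y p A.≈-refl s
      }

    image-corestriction : X ⇒ imageAss
    image-corestriction = record
      { function = record { to = λ x → x ; cong = cong f }
      ; tracked  = I , λ p → _ , I-β , _ , reflˢ Y , p
      }

    image-inclusion-mono : Mono Ass image-inclusion
    image-inclusion-mono {T} {u} {v} = injective-mono image-inclusion (λ p → p) {T} {u} {v}

    corestriction-surjection : TrackedSurjection image-corestriction
    corestriction-surjection = I , λ (x′ , p , q) → x′ , _ , p , I-β , q

  surjection⇒cover : ∀ {X Y} {f : X ⇒ Y} → TrackedSurjection f → Cover Ass f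
  surjection⇒cover {X} {Y} {f} (t , surj) {U} m g mono eq = inverse , m∘inverse , inverse∘m
    where
      inj : ∀ {u u′} → _≈ˢ_ Y (to m u) (to m u′) → _≈ˢ_ U u u′
      inj = mono-injective {m = m} (λ {T} {u} {v} → mono {T} {u} {v})
      preimage : Carrier Y → Carrier X
      preimage y = proj₁ (surj (proj₂ (E-nonempty Y y)))
      f∘preimage : ∀ y → _≈ˢ_ Y (to f (preimage y)) y
      f∘preimage y = proj₁ (proj₂ (proj₂ (surj (proj₂ (E-nonempty Y y)))))
      m∘inverse : ∀ y → _≈ˢ_ Y (to m (to g (preimage y))) y
      m∘inverse y = transˢ Y (eq (preimage y)) (f∘preimage y)
      inverse : Y ⇒ U
      inverse = record
        { function = record
          { to   = λ y → to g (preimage y)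
          ; cong = λ {y} {y′} p → inj (transˢ Y (m∘inverse y) (transˢ Y p (symˢ Y (m∘inverse y′))))
          }
        ; tracked  = proj₁ (tracked g) ⋆ t , λ {y} p →
            let (x , a , q , r , s) = surj p
                (u , r′ , s′) = proj₂ (tracked g) s
            in u , ⋆-β r r′ , E-resp U
                 (inj (transˢ Y (eq x) (transˢ Y q (symˢ Y (m∘inverse y))))) A.≈-refl s′
        }
      inverse∘m : ∀ u → _≈ˢ_ U (to g (preimage (to m u))) u
      inverse∘m u = inj (m∘inverse (to m u))

  cover⇒surjection : ∀ {X Y} {f : X ⇒ Y} → Cover Ass f → TrackedSurjection f
  cover⇒surjection {X} {Y} {f} c
    with c (image-inclusion f) (image-corestriction f) (λ {T} {u} {v} → image-inclusion-mono f {T} {u} {v}) (λ _ → reflˢ Y)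
  ... | i , f∘i , _ = proj₁ (tracked i) , λ {y} p →
    let (a , q , (x , r , s)) = proj₂ (tracked i) p in x , a , transˢ Y r (f∘i y) , q , s

  regularAss : Regular Ass
  regularAss = record
    { ⊤ᶜ          = unitAss
    ; ⊤-terminal  = unit-terminal
    ; Pb          = pullbackAss
    ; p₁          = proj-left
    ; p₂          = proj-right
    ; Pb-pullback = isPullbackAss
    ; Im          = imageAss
    ; coim        = image-corestriction
    ; im          = image-inclusion
    ; im∘coim     = λ {_} {Y} _ _ → reflˢ Y
    ; coim-cover  = λ f → surjection⇒cover {f = image-corestriction f} (corestriction-surjection f)
    ; im-mono     = λ f {T} {u} {v} → image-inclusion-mono f {T} {u} {v}
    ; p₁-cover    = λ {X} {Y} {Z} f g c →
        let (t , surj) = cover⇒surjection {f = g} c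
            (a , track) = tracked f
            term = A.con pair A.∙ A.var zero A.∙ (A.con t A.∙ (A.con a A.∙ A.var zero))
        in surjection⇒cover {f = proj-left f g} (fun term , λ {x} {b} p →
          let (c , q , r) = track p
              (y , d , e , q′ , s) = surj r
              (_ , h , l , l′ , m , n) = pair-β b d
          in (x , y , symˢ Z e) , h , reflˢ X
           , fun-β term (A.⇓app (A.⇓app ⇓con-refl ⇓var-refl l)
                           (A.⇓app ⇓con-refl (A.⇓app ⇓con-refl ⇓var-refl q) q′) l′)
           , (b , m , p) , (d , n , s))
    }

open Assemblies public using (Ass; regularAss)

-- As a category only: that RT A is a topos plays no role below.
RT : ∀ {ℓ : Level} → PCA ℓ → Category (lsuc ℓ) (lsuc ℓ) ℓ
RT A = ExactCompletion.ExReg (regularAss A)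

------------------------------------------------------------------------
-- The functors induced by an applicative morphism

module Induced {ℓ : Level} {A B : PCA ℓ} (γ : ApplicativeMorphism A B) where
  private
    module A = PCA A
    module B = PCA B
    module CA = Combinators A
    open Combinators B
    module AA = Assemblies A
    module AB = Assemblies B
    module CatA = Category (Ass A)
    module CatB = Category (Ass B)
  open AA using (Assembly; AssMorphism)
  open ApplicativeMorphism γ
  open AB.Assembly using (Carrier; _≈ˢ_; reflˢ; symˢ; transˢ)
  open B using (Term; con; var; _∙_; ⇓app)

  mapAss : Assembly → AB.Assembly
  mapAss X = record
    { setoid     = X.setoid
    ; E          = λ x b → ∃ λ a → (a ∈ X.E x) × (b ∈ rel a)
    ; E-resp     = λ p b≈ (a , q , r) → a , X.E-resp p A.≈-refl q , rel-resp A.≈-refl b≈ r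
    ; E-nonempty = λ x → let (a , p) = X.E-nonempty x ; (b , q) = nonempty a in b , a , p , q
    }
    where module X = Assembly X

  private
    -- fun (rᵃ a) maps rel x to rel (a x).
    rᵃ : A.Carrier → Term 1
    rᵃ a = con r ∙ con (proj₁ (nonempty a)) ∙ var zero

    rᵃ-β : ∀ {a x y b} → a A.· x ↦ y → b ∈ rel x → ∃ λ v → (fun (rᵃ a) B.· b ↦ v) × (v ∈ rel y)
    rᵃ-β {a} p q =
      let (u , v , e , e′ , q′) = realize γ p (proj₂ (nonempty a)) q
      in v , fun-β (rᵃ a) (⇓app (⇓app ⇓con-refl ⇓con-refl e) ⇓var-refl e′) , q′

  mapMorphism : ∀ {X Y} → AssMorphism X Y → AB.AssMorphism (mapAss X) (mapAss Y)
  mapMorphism f = record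
    { function = f.function
    ; tracked  = let (a , track) = f.tracked in fun (rᵃ a) , λ (x , p , q) →
        let (y , e , p′) = track p
            (v , e′ , q′) = rᵃ-β e q
        in v , e′ , y , p′ , q′
    }
    where module f = AssMorphism f

  γ*-Ass : Functor (Ass A) (Ass B)
  γ*-Ass = record
    { F₀           = mapAss
    ; F₁           = mapMorphism
    ; F-resp-≈     = λ p → p
    ; identity     = λ {X} _ → Assembly.reflˢ X
    ; homomorphism = λ {_} {_} {Z} _ → Assembly.reflˢ Z
    }

  private
    module F = Functor γ*-Ass

    terminal : ∀ {T} → IsTerminal (Ass A) T → IsTerminal (Ass B) (mapAss T)
    terminal {T} isT = record
      { !        = record
        { function = record { to = λ _ → point ; cong = λ _ → Assembly.reflˢ T }
        ; tracked  = let (b , p) = AB.Assembly.E-nonempty (mapAss T) point in K b , λ _ → b , K-β , p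
        }
      ; !-unique = λ f g x → collapse _ _
      }
      where
        module T = IsTerminal isT
        point : Assembly.Carrier T
        point = AssMorphism.to (T.! {AA.unitAss}) tt
        collapse : ∀ x y → Assembly._≈ˢ_ T x y
        collapse x y = T.!-unique {AA.unitAss} (AA.constant x) (AA.constant y) tt

    chosen-pullback : ∀ {X Y Z} (f : X CatA.⇒ Z) (g : Y CatA.⇒ Z) →
      IsPullback (Ass B) (mapMorphism (AA.proj-left f g)) (mapMorphism (AA.proj-right f g))
                 (mapMorphism f) (mapMorphism g)
    chosen-pullback {X} {Y} f g = record
      { commute   = λ (_ , _ , p) → p
      ; universal = λ {_} {h₁} {h₂} eq →
          let module h₁ = AB.AssMorphism h₁
              module h₂ = AB.AssMorphism h₂
              (t₁ , track₁) = h₁.tracked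
              (t₂ , track₂) = h₂.tracked
              term = con r ∙ (con r ∙ con (proj₁ (nonempty CA.pair)) ∙ (con t₁ ∙ var zero))
                           ∙ (con t₂ ∙ var zero)
          in record
            { function = record { to = λ t → h₁.to t , h₂.to t , eq t ; cong = λ p → h₁.cong p , h₂.cong p }
            ; tracked  = fun term , λ p →
                let (b₁ , e₁ , a₁ , p₁ , q₁) = track₁ p
                    (b₂ , e₂ , a₂ , p₂ , q₂) = track₂ p
                    (_ , c , d , d′ , l , m) = CA.pair-β a₁ a₂
                    (_ , _ , i , j , k) = realize γ d (proj₂ (nonempty CA.pair)) q₁
                    (_ , v , i′ , j′ , k′) = realize γ d′ k q₂
                in v , fun-β term (⇓app (⇓app ⇓con-refl
                         (⇓app (⇓app ⇓con-refl ⇓con-refl i) (⇓app ⇓con-refl ⇓var-refl e₁) j) i′)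
                         (⇓app ⇓con-refl ⇓var-refl e₂) j′)
                     , c , ((a₁ , l , p₁) , (a₂ , m , p₂)) , k′
            }
      ; p₁∘univ   = λ _ _ → Assembly.reflˢ X
      ; p₂∘univ   = λ _ _ → Assembly.reflˢ Y
      ; joint     = λ p q t → p t , q t
      }

    pullback : ∀ {P X Y Z} {p₁ : P CatA.⇒ X} {p₂ : P CatA.⇒ Y} {f : X CatA.⇒ Z} {g : Y CatA.⇒ Z} →
      IsPullback (Ass A) p₁ p₂ f g →
      IsPullback (Ass B) (mapMorphism p₁) (mapMorphism p₂) (mapMorphism f) (mapMorphism g)
    pullback {P} {X} {Y} {p₁ = p₁} {p₂} {f} {g} isP
      with CategoryLemmas.pullback-transport (Ass A) isP (AA.isPullbackAss f g)
    ... | i , j , ji , (q₁i , q₂i) , (p₁j , p₂j) = record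
      { commute   = IsPullback.commute isP
      ; universal = λ {_} {h₁} {h₂} eq → mapMorphism j CatB.∘ Q.universal {_} {h₁} {h₂} eq
      ; p₁∘univ   = λ {_} {h₁} {h₂} eq t → p₁j (AB.AssMorphism.to (Q.universal {_} {h₁} {h₂} eq) t)
      ; p₂∘univ   = λ {_} {h₁} {h₂} eq t → p₂j (AB.AssMorphism.to (Q.universal {_} {h₁} {h₂} eq) t)
      ; joint     = λ {_} {u} {v} eq₁ eq₂ t →
          let x = AB.AssMorphism.to u t
              y = AB.AssMorphism.to v t in
          Assembly.transˢ P (Assembly.symˢ P (ji x))
            (Assembly.transˢ P (AssMorphism.cong j {AssMorphism.to i x} {AssMorphism.to i y}
              ( Assembly.transˢ X (q₁i x) (Assembly.transˢ X (eq₁ t) (Assembly.symˢ X (q₁i y)))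
              , Assembly.transˢ Y (q₂i x) (Assembly.transˢ Y (eq₂ t) (Assembly.symˢ Y (q₂i y)))))
              (ji y))
      }
      where
        module Q = IsPullback (chosen-pullback f g)

    cover : ∀ {X Y} {f : X CatA.⇒ Y} → Cover (Ass A) f → Cover (Ass B) (mapMorphism f)
    cover {f = f} c with AA.cover⇒surjection {f = f} c
    ... | t , surj = AB.surjection⇒cover {f = mapMorphism f} (fun (rᵃ t) , λ (a , p , q) →
      let (x , a′ , e , e′ , p′) = surj p
          (v , i , q′) = rᵃ-β e′ q
      in x , v , e , i , a′ , p′ , q′)

  γ*-regular : Functor.IsRegularFunctor γ*-Ass
  γ*-regular = record
    { leftExact = record { terminal = terminal ; pullback = pullback }
    ; cover     = λ {_} {_} {f} → cover {f = f}
    }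

  γ* : Functor (RT A) (RT B)
  γ* = RegularExtension.extension (regularAss A) (regularAss B) γ*-Ass γ*-regular

open Induced public using (γ*)

-- The geometric morphism RT B → RT A induced by γ is the one with inverse image γ*.
IsInducedBy : ∀ {ℓ : Level} {A B : PCA ℓ} →
              GeometricMorphism (RT B) (RT A) → ApplicativeMorphism A B → Set (lsuc ℓ)
IsInducedBy f γ = NaturalIsomorphism (GeometricMorphism.inverseImage f) (γ* γ)

{-# OPTIONS --safe #-}
module Submission where

-- Let ε : γ*f₊Y → Y be the counit of f, transported along the isomorphism f* ≅ γ*; the
-- direct image is full and faithful if and only if every ε is an isomorphism.
--
-- Given δ with γδ ≃ id, let u : T → γ*W be a map of assemblies over B.  Put on the set
-- underlying T the codes of pairs from δ(E(x)) and E(u(x)).  The resulting assembly T′ over A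
-- has γ*T′ ≅ T, and along this isomorphism u is the image of the projection T′ → W.  So maps
-- into the base of γ*f₊Y come from maps into f₊Y, and the universal property of ε makes it
-- injective.  It is also surjective, because the base of Y is itself of the form γ*T′.
--
-- Conversely, a section of ε at the assembly (B , b ↦ {b}) gives s, t ∈ B such that for
-- every b some a has tb ∈ γ(a) and sγ(a) = {b}.  Density replaces s by the fixed m, at the
-- cost of moving a along a single element of A, and δ(b) = {a | mγ(a) = {b}}.

open import Defs
open import Level using (Level; _⊔_)
open import Data.Fin.Base using (zero; suc)
open import Data.Vec.Base using ([]; _∷_)
open import Data.Product.Base using (Σ-syntax; ∃; _×_; _,_; proj₁; proj₂)
open import Function.Bundles using (_⇔_; mk⇔)
open import Relation.Unary using (_∈_)

-- The transported counit of a geometric morphism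

-- A terminal object of the comma category of `G` over `Y`. The later arguments use the counit only
-- through this property, so the adjunction itself does not enter them.
record CouniversalArrow {o h e o′ h′ e′ : Level} {C : Category o h e} {D : Category o′ h′ e′}
       (G : Functor C D) (Y : Category.Obj D) : Set (o ⊔ h ⊔ e ⊔ h′ ⊔ e′) where
  private
    module C = Category C
    module G = Functor G
  open Category D
  field
    object : C.Obj
    arrow  : G.F₀ object ⇒ Y
    transpose        : ∀ {Z} (k : G.F₀ Z ⇒ Y) → Σ[ g ∈ Z C.⇒ object ] arrow ∘ G.F₁ g ≈ k
    transpose-unique : ∀ {Z} {g g′ : Z C.⇒ object} → arrow ∘ G.F₁ g ≈ arrow ∘ G.F₁ g′ → g C.≈ g′

module InverseImage {o h e o′ h′ e′ : Level} {E : Category o h e} {F : Category o′ h′ e′}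
       (f : GeometricMorphism E F) (G : Functor F E)
       (θ : NaturalIsomorphism (GeometricMorphism.inverseImage f) G) where
  open Category E
  open CategoryLemmas E
  private
    module F where
      open Category F public
      open CategoryLemmas F public
    module f = GeometricMorphism f
    module L = Functor f.inverseImage
    module R = Functor f.directImage
    module G = Functor G
    open NaturalIsomorphism θ
    open _⊣_ f.adjunction
    open HomReasoning

    η⁻¹ : ∀ Z → G.F₀ Z ⇒ L.F₀ Z
    η⁻¹ Z = proj₁ (iso Z)

    η∘η⁻¹ : ∀ {Z} → η Z ∘ η⁻¹ Z ≈ id
    η∘η⁻¹ {Z} = proj₁ (proj₂ (iso Z))

    η⁻¹∘η : ∀ {Z} → η⁻¹ Z ∘ η Z ≈ id
    η⁻¹∘η {Z} = proj₂ (proj₂ (iso Z))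

    η⁻¹-natural : ∀ {X Y} (g : X F.⇒ Y) → η⁻¹ Y ∘ G.F₁ g ≈ L.F₁ g ∘ η⁻¹ X
    η⁻¹-natural {X} {Y} g = begin
      η⁻¹ Y ∘ G.F₁ g                    ≈⟨ η⁻¹ Y ∘⟨ identityʳ ⟨
      η⁻¹ Y ∘ (G.F₁ g ∘ id)             ≈⟨ η⁻¹ Y ∘⟨ G.F₁ g ∘⟨ η∘η⁻¹ ⟨
      η⁻¹ Y ∘ (G.F₁ g ∘ (η X ∘ η⁻¹ X))  ≈⟨ η⁻¹ Y ∘⟨ pullˡ (≈-sym (natural g)) ⟩
      η⁻¹ Y ∘ ((η Y ∘ L.F₁ g) ∘ η⁻¹ X)  ≈⟨ η⁻¹ Y ∘⟨ assoc ⟩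
      η⁻¹ Y ∘ (η Y ∘ (L.F₁ g ∘ η⁻¹ X))  ≈⟨ pullˡ η⁻¹∘η ⟩
      id ∘ (L.F₁ g ∘ η⁻¹ X)             ≈⟨ identityˡ ⟩
      L.F₁ g ∘ η⁻¹ X                    ∎

    ε : ∀ Y → G.F₀ (R.F₀ Y) ⇒ Y
    ε Y = counit Y ∘ η⁻¹ (R.F₀ Y)

    ε∘G : ∀ {Z Y} (g : Z F.⇒ R.F₀ Y) → ε Y ∘ G.F₁ g ≈ (counit Y ∘ L.F₁ g) ∘ η⁻¹ Z
    ε∘G {Z} {Y} g = begin
      (counit Y ∘ η⁻¹ (R.F₀ Y)) ∘ G.F₁ g  ≈⟨ assoc ⟩
      counit Y ∘ (η⁻¹ (R.F₀ Y) ∘ G.F₁ g)  ≈⟨ counit Y ∘⟨ η⁻¹-natural g ⟩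
      counit Y ∘ (L.F₁ g ∘ η⁻¹ Z)         ≈⟨ assoc ⟨
      (counit Y ∘ L.F₁ g) ∘ η⁻¹ Z         ∎

    ε-natural : ∀ {Y Y′} (g : Y ⇒ Y′) → ε Y′ ∘ G.F₁ (R.F₁ g) ≈ g ∘ ε Y
    ε-natural {Y} {Y′} g = begin
      ε Y′ ∘ G.F₁ (R.F₁ g)                           ≈⟨ ε∘G (R.F₁ g) ⟩
      (counit Y′ ∘ L.F₁ (R.F₁ g)) ∘ η⁻¹ (R.F₀ Y)     ≈⟨ counit-natural g ⟩∘ _ ⟩
      (g ∘ counit Y) ∘ η⁻¹ (R.F₀ Y)                  ≈⟨ assoc ⟩
      g ∘ ε Y                                        ∎

    -- The usual adjoint transpose, taken of `k ∘ η Z` because the adjunction speaks of `L` and not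
    -- of `G`.
    counit-transpose : ∀ {Z Y} (k : G.F₀ Z ⇒ Y) → Σ[ g ∈ Z F.⇒ R.F₀ Y ] ε Y ∘ G.F₁ g ≈ k
    counit-transpose {Z} {Y} k = R.F₁ k′ F.∘ unit Z , (begin
        ε Y ∘ G.F₁ (R.F₁ k′ F.∘ unit Z)                        ≈⟨ ε∘G _ ⟩
        (counit Y ∘ L.F₁ (R.F₁ k′ F.∘ unit Z)) ∘ η⁻¹ Z         ≈⟨ (counit Y ∘⟨ L.homomorphism) ⟩∘ _ ⟩
        (counit Y ∘ (L.F₁ (R.F₁ k′) ∘ L.F₁ (unit Z))) ∘ η⁻¹ Z  ≈⟨ pullˡ (counit-natural k′) ⟩∘ _ ⟩
        ((k′ ∘ counit (L.F₀ Z)) ∘ L.F₁ (unit Z)) ∘ η⁻¹ Z       ≈⟨ assoc ⟩∘ _ ⟩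
        (k′ ∘ (counit (L.F₀ Z) ∘ L.F₁ (unit Z))) ∘ η⁻¹ Z       ≈⟨ (k′ ∘⟨ zig Z) ⟩∘ _ ⟩
        (k′ ∘ id) ∘ η⁻¹ Z                                      ≈⟨ identityʳ ⟩∘ _ ⟩
        (k ∘ η Z) ∘ η⁻¹ Z                                      ≈⟨ assoc ⟩
        k ∘ (η Z ∘ η⁻¹ Z)                                      ≈⟨ k ∘⟨ η∘η⁻¹ ⟩
        k ∘ id                                                 ≈⟨ identityʳ ⟩
        k                                                      ∎)
      where
        k′ : L.F₀ Z ⇒ Y
        k′ = k ∘ η Z

    counit-transpose-unique : ∀ {Z Y} {g g′ : Z F.⇒ R.F₀ Y} → ε Y ∘ G.F₁ g ≈ ε Y ∘ G.F₁ g′ → g F.≈ g′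
    counit-transpose-unique {Z} {Y} {g} {g′} eq =
      F.≈-trans (F.≈-sym (untranspose g)) (F.≈-trans (R.F-resp-≈ eq′ F.⟩∘ unit Z) (untranspose g′))
      where
        untranspose : ∀ g → R.F₁ (counit Y ∘ L.F₁ g) F.∘ unit Z F.≈ g
        untranspose g =
          F.≈-trans (R.homomorphism F.⟩∘ unit Z)
            (F.≈-trans F.assoc
              (F.≈-trans (R.F₁ (counit Y) F.∘⟨ F.≈-sym (unit-natural g))
                (F.≈-trans (F.pullˡ (zag Y)) F.identityˡ)))
        cancel : ∀ g → (ε Y ∘ G.F₁ g) ∘ η Z ≈ counit Y ∘ L.F₁ g
        cancel g = begin
          (ε Y ∘ G.F₁ g) ∘ η Z                  ≈⟨ ε∘G g ⟩∘ η Z ⟩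
          ((counit Y ∘ L.F₁ g) ∘ η⁻¹ Z) ∘ η Z   ≈⟨ assoc ⟩
          (counit Y ∘ L.F₁ g) ∘ (η⁻¹ Z ∘ η Z)   ≈⟨ _ ∘⟨ η⁻¹∘η ⟩
          (counit Y ∘ L.F₁ g) ∘ id              ≈⟨ identityʳ ⟩
          counit Y ∘ L.F₁ g                     ∎
        eq′ : counit Y ∘ L.F₁ g ≈ counit Y ∘ L.F₁ g′
        eq′ = ≈-trans (≈-sym (cancel g)) (≈-trans (eq ⟩∘ η Z) (cancel g′))

  counit-couniversal : ∀ Y → CouniversalArrow G Y
  counit-couniversal Y = record
    { object           = R.F₀ Y
    ; arrow            = ε Y
    ; transpose        = counit-transpose
    ; transpose-unique = counit-transpose-unique
    }

  -- Fullness turns the unit at `R Y` into `R k` with `k : Y ⇒ L (R Y)`. A triangle identity then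
  -- makes `R (counit ∘ k)` the identity, and faithfulness removes the `R`. A section of the counit
  -- is all that the search for δ needs.
  inclusion⇒split : IsInclusion f → ∀ Y →
                    Σ[ k ∈ _ ] CouniversalArrow.arrow (counit-couniversal Y) ∘ k ≈ id
  inclusion⇒split (full , faithful) Y =
    let (k , Rk≈unit) = full (unit (R.F₀ Y)) in
    η (R.F₀ Y) ∘ k , (begin
      (counit Y ∘ η⁻¹ (R.F₀ Y)) ∘ (η (R.F₀ Y) ∘ k)  ≈⟨ assoc ⟩
      counit Y ∘ (η⁻¹ (R.F₀ Y) ∘ (η (R.F₀ Y) ∘ k))  ≈⟨ counit Y ∘⟨ pullˡ η⁻¹∘η ⟩
      counit Y ∘ (id ∘ k)                           ≈⟨ counit Y ∘⟨ identityˡ ⟩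
      counit Y ∘ k                                  ≈⟨ faithful (F.≈-trans R.homomorphism
        (F.≈-trans (R.F₁ (counit Y) F.∘⟨ Rk≈unit) (F.≈-trans (zag Y) (F.≈-sym R.identity)))) ⟩
      id                                            ∎)

  -- By naturality `R g` determines `g ∘ ε Y`, and `ε Y` is epi: this is faithfulness. For fullness,
  -- conjugate `G g` by the two counits.
  iso⇒inclusion : (∀ Y → IsIso E (CouniversalArrow.arrow (counit-couniversal Y))) → IsInclusion f
  iso⇒inclusion ε-iso = full , faithful
    where
      faithful : R.Faithful
      faithful {Y} {Y′} {g} {g′} eq = begin
        g                 ≈⟨ identityʳ ⟨
        g ∘ id            ≈⟨ g ∘⟨ ε∘ε⁻¹ ⟨
        g ∘ (ε Y ∘ ε⁻¹)   ≈⟨ pullˡ (≈-trans (≈-sym (ε-natural g))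
                               (≈-trans (ε Y′ ∘⟨ G.F-resp-≈ eq) (ε-natural g′))) ⟩
        (g′ ∘ ε Y) ∘ ε⁻¹  ≈⟨ assoc ⟩
        g′ ∘ (ε Y ∘ ε⁻¹)  ≈⟨ g′ ∘⟨ ε∘ε⁻¹ ⟩
        g′ ∘ id           ≈⟨ identityʳ ⟩
        g′                ∎
        where
          ε⁻¹ = proj₁ (ε-iso Y)
          ε∘ε⁻¹ = proj₁ (proj₂ (ε-iso Y))
      full : R.Full
      full {Y} {Y′} g = k , counit-transpose-unique (begin
        ε Y′ ∘ G.F₁ (R.F₁ k)              ≈⟨ ε-natural k ⟩
        k ∘ ε Y                           ≈⟨ assoc ⟩
        (ε Y′ ∘ G.F₁ g) ∘ (ε⁻¹ ∘ ε Y)     ≈⟨ _ ∘⟨ proj₂ (proj₂ (ε-iso Y)) ⟩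
        (ε Y′ ∘ G.F₁ g) ∘ id              ≈⟨ identityʳ ⟩
        ε Y′ ∘ G.F₁ g                     ∎)
        where
          ε⁻¹ = proj₁ (ε-iso Y)
          k : Y ⇒ Y′
          k = (ε Y′ ∘ G.F₁ g) ∘ ε⁻¹

-- Exact completions

module ExactCompletionLemmas {o h e : Level} {C : Category o h e} (reg : Regular C) where
  open Category C
  open CategoryLemmas C
  open Relations C
  open Regular reg
  open RegularLemmas reg
  open ExactCompletion reg
  open FunctionalRelation using (graph)
  open Quotient using (base; eqv)

  -- The embedding of the regular category into its completion: the equivalence relation is the
  -- diagonal.
  discrete : Obj → Quotient
  discrete T = record
    { base    = T
    ; eqv     = record { apex = T ; π₁ = id ; π₂ = id
                       ; joint = λ p _ → ≈-trans (≈-sym identityˡ) (≈-trans p identityˡ) }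
    ; isEquiv = record
      { reflexive  = λ {_} {x} → x , identityˡ , identityˡ
      ; symmetric  = λ (t , a , b) → t , b , a
      ; transitive = λ (t , a , b) (_ , a′ , b′) → t , a , ≈-trans b (≈-trans (≈-sym a′) b′)
      }
    }

  -- Values of a total relation exist only locally: the cover is the pullback of `π₁` along `x`.
  total-elim : ∀ {X Y T} (R : Rel X Y) → Cover C (Rel.π₁ R) → (x : T ⇒ X) →
               Σ[ T′ ∈ Obj ] Σ[ c ∈ T′ ⇒ T ] Cover C c × Σ[ y ∈ T′ ⇒ Y ] R ∋⟨ x ∘ c , y ⟩
  total-elim R cover x =
      Pb x π₁ , p₁ x π₁ , p₁-cover x π₁ cover
    , π₂ ∘ p₂ x π₁ , p₂ x π₁ , ≈-sym (Pb.commute x π₁) , ≈-refl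
    where open Rel R

  -- After restriction along a cover, `z` factors through the second leg of `S`; a map through which
  -- a cover factors last is a cover.
  ⨾-surjective : ∀ {X Y Z T} (R : Rel X Y) (S : Rel Y Z) {x : T ⇒ X} {z : T ⇒ Z} →
                 Cover C z → R ⨾ S ∋⟨ x , z ⟩ → Cover C (Rel.π₂ S)
  ⨾-surjective R S cover p =
    let (_ , _ , c , _ , _ , _ , _ , q) = ⨾-elim R S p in
    cover-cancel (cover-resp (≈-sym q) (cover-∘ cover c))

  ⨾-least : ∀ {X Y Z} (R : Rel X Y) (S : Rel Y Z) (U : Rel X Z) →
            (∀ {T} {x : T ⇒ X} {y : T ⇒ Y} {z : T ⇒ Z} →
               R ∋⟨ x , y ⟩ → S ∋⟨ y , z ⟩ → U ∋⟨ x , z ⟩) →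
            R ⨾ S ⊑ U
  ⨾-least R S U f =
    let (_ , _ , c , _ , a , b) = ⨾-elim R S (generic (R ⨾ S)) in ∋-descend U c (f a b)

  module _ {X Y : Quotient} (x : base X ⇒ base Y)
           (x-resp : ∀ {T} {a b : T ⇒ base X} → eqv X ∋⟨ a , b ⟩ → eqv Y ∋⟨ x ∘ a , x ∘ b ⟩) where
    private
      module X = Quotient X
      module Y = Quotient Y
      module ∼ = Rel Y.eqv

      -- The bare graph of `x` is not saturated. Pulling `x` back along the first leg of `Y.eqv`
      -- gives the pairs (a, y) with x a equivalent to y.
      R : Rel X.base Y.base
      R = record
        { apex  = Pb x ∼.π₁
        ; π₁    = p₁ x ∼.π₁
        ; π₂    = ∼.π₂ ∘ p₂ x ∼.π₁
        ; joint = λ p q → Pb.joint x ∼.π₁ p (∼.joint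
            (≈-trans (pullˡ (≈-sym (Pb.commute x ∼.π₁))) (≈-trans (≈-trans assoc (≈-trans (x ∘⟨ p)
              (≈-sym assoc))) (≈-sym (pullˡ (≈-sym (Pb.commute x ∼.π₁))))))
            (≈-trans (≈-sym assoc) (≈-trans q assoc)))
        }

      intro : ∀ {T} {a : T ⇒ X.base} {y : T ⇒ Y.base} → Y.eqv ∋⟨ x ∘ a , y ⟩ → R ∋⟨ a , y ⟩
      intro (t , p , q) =
          Pb.universal x ∼.π₁ (≈-sym p) , Pb.p₁∘univ x ∼.π₁ _
        , ≈-trans assoc (≈-trans (∼.π₂ ∘⟨ Pb.p₂∘univ x ∼.π₁ _) q)

      elim : ∀ {T} {a : T ⇒ X.base} {y : T ⇒ Y.base} → R ∋⟨ a , y ⟩ → Y.eqv ∋⟨ x ∘ a , y ⟩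
      elim (t , p , q) =
          p₂ x ∼.π₁ ∘ t
        , ≈-trans (pullˡ (≈-sym (Pb.commute x ∼.π₁))) (≈-trans assoc (x ∘⟨ p))
        , ≈-trans (≈-sym assoc) q

    abstract
      represented : FunctionalRelation X Y
      represented = record
        { graph        = R
        ; saturated    = λ p q r → intro (Y.transitive (x-resp p) (Y.transitive (elim q) r))
        ; singleValued = λ p q → Y.transitive (Y.symmetric (elim p)) (elim q)
        ; total        = total-intro R id-cover (intro Y.reflexive)
        }

      represented-intro : ∀ {T} {a : T ⇒ X.base} {y : T ⇒ Y.base} →
                          Y.eqv ∋⟨ x ∘ a , y ⟩ → graph represented ∋⟨ a , y ⟩
      represented-intro = intro

      represented-elim : ∀ {T} {a : T ⇒ X.base} {y : T ⇒ Y.base} →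
                         graph represented ∋⟨ a , y ⟩ → Y.eqv ∋⟨ x ∘ a , y ⟩
      represented-elim = elim

  element : ∀ {T} (Y : Quotient) → T ⇒ base Y → FunctionalRelation (discrete T) Y
  element Y x = represented x (λ (_ , p , q) →
    ∋-resp Y.eqv (x ∘⟨ p) (x ∘⟨ q) Y.reflexive)
    where module Y = Quotient Y

  element-intro : ∀ {T} (Y : Quotient) (x : T ⇒ base Y) {S} {a : S ⇒ T} {y : S ⇒ base Y} →
                  eqv Y ∋⟨ x ∘ a , y ⟩ → graph (element Y x) ∋⟨ a , y ⟩
  element-intro Y x = represented-intro x _

  element-elim : ∀ {T} (Y : Quotient) (x : T ⇒ base Y) {S} {a : S ⇒ T} {y : S ⇒ base Y} →
                 graph (element Y x) ∋⟨ a , y ⟩ → eqv Y ∋⟨ x ∘ a , y ⟩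
  element-elim Y x = represented-elim x _

  -- The converse relation is the inverse: surjectivity is its totality and injectivity its
  -- single-valuedness.
  bijective⇒iso : ∀ {X Y} (F : FunctionalRelation X Y) → Cover C (Rel.π₂ (graph F)) →
    (∀ {T} {x x′ : T ⇒ base X} {y : T ⇒ base Y} →
       graph F ∋⟨ x , y ⟩ → graph F ∋⟨ x′ , y ⟩ → eqv X ∋⟨ x , x′ ⟩) →
    IsIso ExReg F
  bijective⇒iso {X} {Y} F surjective injective =
      inverse
    , ( ⨾-least F°.graph F.graph Y.eqv (λ a b → F.singleValued (converse F°.graph a) b)
      , (let (_ , e , c , _ , a) = total-elim F°.graph surjective (Rel.π₁ Y.eqv)
         in ∋-descend (F°.graph ⨾ F.graph) c (⨾-intro F°.graph F.graph a
              (F.saturated X.reflexive (converse F°.graph a) (∋-restrict Y.eqv e (generic Y.eqv))))))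
    , ( ⨾-least F.graph F°.graph X.eqv (λ a b → injective a (converse F°.graph b))
      , (let (_ , e , c , _ , a) = total-elim F.graph F.total (Rel.π₁ X.eqv)
         in ∋-descend (F.graph ⨾ F°.graph) c (⨾-intro F.graph F°.graph a
              (converse F.graph (F.saturated
                (X.symmetric (∋-restrict X.eqv e (generic X.eqv))) a Y.reflexive)))))
    where
      module X = Quotient X
      module Y = Quotient Y
      module F = FunctionalRelation F

      _° : ∀ {U V} → Rel U V → Rel V U
      R ° = record { apex = apex ; π₁ = π₂ ; π₂ = π₁ ; joint = λ p q → joint q p }
        where open Rel R

      converse : ∀ {U V T} (R : Rel U V) {u : T ⇒ U} {v : T ⇒ V} → R ∋⟨ u , v ⟩ → R ° ∋⟨ v , u ⟩
      converse _ (t , a , b) = t , b , a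

      inverse : FunctionalRelation Y X
      inverse = record
        { graph        = F.graph °
        ; saturated    = λ p q r → converse F.graph
            (F.saturated (X.symmetric r) (converse (F.graph °) q) (Y.symmetric p))
        ; singleValued = λ p q → injective (converse (F.graph °) p) (converse (F.graph °) q)
        ; total        = surjective
        }
      module F° = FunctionalRelation inverse

-- Couniversal arrows for a regular functor along which maps lift

module RegularExtensionLemmas {o h e o′ h′ e′ : Level} {C : Category o h e} {D : Category o′ h′ e′}
       (regC : Regular C) (regD : Regular D) (F : Functor C D)
       (isReg : Functor.IsRegularFunctor F) where
  private
    module C where
      open Category C public
      open CategoryLemmas C public
      open Relations C public
      open FunctionalRelation public using (graph)
      open Regular regC public
      open RegularLemmas regC public
      open ExactCompletion regC public
      open ExactCompletionLemmas regC public
    module D where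
      open Category D public
      open CategoryLemmas D public
      open Relations D public
      open FunctionalRelation public using (graph)
      open RegularLemmas regD public
      open ExactCompletion regD public
      open ExactCompletionLemmas regD public
  open Functor F
  open Functor.IsRegularFunctor isReg
  open RegularExtension regC regD F isReg

  -- `T` is exhibited as a retract of some `F₀ T′` on which `u` comes from a map `w` of `C`. A
  -- retract suffices, since relations proved over `F₀ T′` restrict along `i`.
  Lift : ∀ {T W} → T D.⇒ F₀ W → Set (o ⊔ h ⊔ h′ ⊔ e′)
  Lift {T} {W} u =
    Σ[ T′ ∈ C.Obj ] Σ[ w ∈ T′ C.⇒ W ] Σ[ i ∈ T D.⇒ F₀ T′ ] Σ[ j ∈ F₀ T′ D.⇒ T ]
      (j D.∘ i D.≈ D.id) × (F₁ w D.≈ u D.∘ j)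

  LiftsMaps : Set (o ⊔ h ⊔ o′ ⊔ h′ ⊔ e′)
  LiftsMaps = ∀ {T W} (u : T D.⇒ F₀ W) → Lift {T} {W} u

  module _ (lifts : LiftsMaps) {Y : D.Quotient} (couniversal : CouniversalArrow extension Y) where
    private
      open CouniversalArrow couniversal renaming (object to W; arrow to ε)
      module W = C.Quotient W
      module Y = D.Quotient Y
      module LW = D.Quotient (mapQuotient W)
      module ε = D.FunctionalRelation ε

      -- Lifting the map to the terminal object only serves to make `Y.base` a retract of some
      -- `F₀ T′`. The map `k` represented by `j` factors through `ε` and relates `i` to the identity
      -- of `Y.base`, so `ε` reaches everything.
      surjective : Cover D (D.Rel.π₂ ε.graph)
      surjective = from-lift (lifts !)
        where
          ! : Y.base D.⇒ F₀ C.⊤ᶜ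
          ! = IsTerminal.! (terminal C.⊤-terminal)
          from-lift : Lift {W = C.⊤ᶜ} ! → Cover D (D.Rel.π₂ ε.graph)
          from-lift (T′ , _ , i , j , ji , _) = D.⨾-surjective (mapRel (C.graph g)) ε.graph D.id-cover
            (D.⊑-apply (D.graph k) (D.graph (ε D.∘ᶠ mapFunctional {C.discrete T′} {W} g))
              (proj₂ (proj₂ (transpose {C.discrete T′} k)))
              (D.represented-intro j j-resp {a = i} {y = D.id} (D.∋-resp Y.eqv D.≈-refl ji Y.reflexive)))
            where
              j-resp : ∀ {T} {a b : T D.⇒ F₀ T′} → mapRel (C.Quotient.eqv (C.discrete T′)) D.∋⟨ a , b ⟩ →
                       Y.eqv D.∋⟨ j D.∘ a , j D.∘ b ⟩
              j-resp (_ , p , q) = D.∋-resp Y.eqv (j D.∘⟨ unit p) (j D.∘⟨ unit q) Y.reflexive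
                where
                  unit : ∀ {T} {t a : T D.⇒ F₀ T′} → F₁ C.id D.∘ t D.≈ a → t D.≈ a
                  unit = D.≈-trans (D.≈-sym (D.≈-trans (identity D.⟩∘ _) D.identityˡ))
              k : D.FunctionalRelation (mapQuotient (C.discrete T′)) Y
              k = D.represented j j-resp
              g : C.FunctionalRelation (C.discrete T′) W
              g = proj₁ (transpose {C.discrete T′} k)

      image : ∀ {T} → T C.⇒ W.base → D.FunctionalRelation (mapQuotient (C.discrete T)) (mapQuotient W)
      image {T} w = mapFunctional {C.discrete T} {W} (C.element W w)

      image-∋ : ∀ {T} (w : T C.⇒ W.base) {U} (t : U D.⇒ F₀ T) →
                D.graph (image w) D.∋⟨ t , F₁ w D.∘ t ⟩
      image-∋ w t = D.∋-resp (D.graph (image w))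
        (D.≈-trans (identity D.⟩∘ t) D.identityˡ) (F-resp-≈ C.identityʳ D.⟩∘ t)
        (D.∋-restrict (D.graph (image w)) t (map-∋ (C.graph (C.element W w))
          (C.element-intro W w W.reflexive)))

      image-⊑ : ∀ {T} (w w′ : T C.⇒ W.base) {y : F₀ T D.⇒ Y.base} →
        ε.graph D.∋⟨ F₁ w , y ⟩ → ε.graph D.∋⟨ F₁ w′ , y ⟩ →
        D.graph (ε D.∘ᶠ image w) D.⊑ D.graph (ε D.∘ᶠ image w′)
      image-⊑ w w′ p p′ =
        D.⨾-least (D.graph (image w)) ε.graph (D.graph (ε D.∘ᶠ image w′)) λ {_} {t} a b →
          D.⨾-intro (D.graph (image w′)) ε.graph (image-∋ w′ t)
            (ε.saturated LW.reflexive (D.∋-restrict ε.graph t p′)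
              (ε.singleValued (D.∋-restrict ε.graph t p)
                (ε.saturated (D.FunctionalRelation.singleValued (image w) (image-∋ w t) a) b Y.reflexive)))

      -- The elements `w` and `w′` have equal composites with `ε`, so uniqueness of transposes
      -- identifies them already over `C`.
      injective-image : ∀ {T} (w w′ : T C.⇒ W.base) {y : F₀ T D.⇒ Y.base} →
        ε.graph D.∋⟨ F₁ w , y ⟩ → ε.graph D.∋⟨ F₁ w′ , y ⟩ → W.eqv C.∋⟨ w , w′ ⟩
      injective-image w w′ p p′ =
        C.∋-resp W.eqv C.identityʳ C.identityʳ (W.symmetric (C.element-elim W w′
          (C.⊑-apply (C.graph (C.element W w)) (C.graph (C.element W w′))
            (proj₁ (transpose-unique {C.discrete _} {g = C.element W w} {g′ = C.element W w′}
              (image-⊑ w w′ p p′ , image-⊑ w′ w p′ p)))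
            (C.element-intro W w {a = C.id} W.reflexive))))

      -- Lifting the pair, and not each component, puts both elements over one `T′`, where
      -- `injective-image` applies; the result is then restricted along `i`.
      injective : ∀ {T} {x x′ : T D.⇒ LW.base} {y : T D.⇒ Y.base} →
        ε.graph D.∋⟨ x , y ⟩ → ε.graph D.∋⟨ x′ , y ⟩ → LW.eqv D.∋⟨ x , x′ ⟩
      injective {T} {x} {x′} {y} p p′ = from-lift (lifts ⟨x,x′⟩)
        where
          module P = IsPullback (pullback (C.Pb-pullback (C.⊤ᶜ.! {W.base}) (C.⊤ᶜ.! {W.base})))
          eq : F₁ C.⊤ᶜ.! D.∘ x D.≈ F₁ C.⊤ᶜ.! D.∘ x′
          eq = IsTerminal.!-unique (terminal C.⊤-terminal) _ _
          ⟨x,x′⟩ : T D.⇒ F₀ (W.base C.×ᶜ W.base)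
          ⟨x,x′⟩ = P.universal eq

          from-lift : Lift {W = W.base C.×ᶜ W.base} ⟨x,x′⟩ → LW.eqv D.∋⟨ x , x′ ⟩
          from-lift (T′ , w , i , j , ji , w≈) = D.∋-resp LW.eqv (retract fst-w) (retract snd-w)
            (D.∋-restrict LW.eqv i (map-∋ W.eqv (injective-image (C.fstᶜ C.∘ w) (C.sndᶜ C.∘ w)
              (D.∋-resp ε.graph (D.≈-sym fst-w) D.≈-refl (D.∋-restrict ε.graph j p))
              (D.∋-resp ε.graph (D.≈-sym snd-w) D.≈-refl (D.∋-restrict ε.graph j p′)))))
            where
              component : ∀ {V} {q : W.base C.×ᶜ W.base C.⇒ V} {v} → F₁ q D.∘ ⟨x,x′⟩ D.≈ v →
                          F₁ (q C.∘ w) D.≈ v D.∘ j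
              component q≈ = D.≈-trans homomorphism (D.≈-trans (_ D.∘⟨ w≈) (D.pullˡ q≈))
              fst-w : F₁ (C.fstᶜ C.∘ w) D.≈ x D.∘ j
              fst-w = component (P.p₁∘univ eq)
              snd-w : F₁ (C.sndᶜ C.∘ w) D.≈ x′ D.∘ j
              snd-w = component (P.p₂∘univ eq)
              retract : ∀ {v : T D.⇒ LW.base} {u} → u D.≈ v D.∘ j → u D.∘ i D.≈ v
              retract u≈ = D.≈-trans (u≈ D.⟩∘ i) (D.≈-trans D.assoc (D.≈-trans (_ D.∘⟨ ji) D.identityʳ))

    couniversal⇒iso : IsIso D.ExReg (CouniversalArrow.arrow couniversal)
    couniversal⇒iso = D.bijective⇒iso ε surjective injective

-- Realizability

module _ {ℓ : Level} {A B : PCA ℓ} (γ : ApplicativeMorphism A B) where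
  private
    module A = PCA A
    module CA = Combinators A
    module AA = Assemblies A
    module AB = Assemblies B
    module γ = ApplicativeMorphism γ
  open PCA B
  open Combinators B
  open Relations (Ass B) using (FunctionalRelation)
  open Relations (Ass A) using (Quotient)
  open ExactCompletion (regularAss B) using (_∘ᶠ_; _≈ᶠ_; idᶠ)
  open ExactCompletionLemmas (regularAss B) using (discrete; ⨾-surjective)
  open Induced γ using (mapAss; γ*-Ass; γ*-regular)
  open RegularExtension (regularAss A) (regularAss B) γ*-Ass γ*-regular using (mapQuotient)
  open RegularExtensionLemmas (regularAss A) (regularAss B) γ*-Ass γ*-regular using (LiftsMaps)

  private
    -- With a chosen element of γ(a) fixed, this term carries γ(x) into γ(ax).
    realizer : A.Carrier → Term 1
    realizer a = con γ.r ∙ con (proj₁ (γ.nonempty a)) ∙ var zero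

    realizer-⇓ : ∀ {a x y b} → a A.· x ↦ y → b ∈ γ.rel x →
                 ∃ λ v → (realizer a [ b ∷ [] ]⇓ v) × (v ∈ γ.rel y)
    realizer-⇓ {a} p q =
      let (_ , v , e , e′ , v∈) = realize γ p (proj₂ (γ.nonempty a)) q
      in v , ⇓app (⇓app ⇓con-refl ⇓con-refl e) ⇓var-refl e′ , v∈

  -- From a section of γ to lifts of maps

  module _ (δ : ApplicativeMorphism B A) (γδ≃id : (γ ∘ᵃ δ) ≃ idᵃ B) where
    private
      module δ = ApplicativeMorphism δ

      module Lift {T : AB.Assembly} {W : AA.Assembly} (u : AB.AssMorphism T (mapAss W)) where
        module T = AB.Assembly T
        module W = AA.Assembly W
        module u = AB.AssMorphism u
        module δT = AA.Assembly (Induced.mapAss δ T)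

        -- The first component of a code lets `retraction` recover a realizer in `T`; the second
        -- tracks `map` over `A`.
        domain : AA.Assembly
        domain = record
          { setoid     = T.setoid
          ; E          = λ x c → (∃ λ a → (CA.fst A.· c ↦ a) × (a ∈ δT.E x)) ×
                                 (∃ λ d → (CA.snd A.· c ↦ d) × (d ∈ W.E (u.to x)))
          ; E-resp     = λ p c≈ ((a , q , a∈) , (d , q′ , d∈)) →
              (a , A.↦-resp A.≈-refl c≈ A.≈-refl q , δT.E-resp p A.≈-refl a∈) ,
              (d , A.↦-resp A.≈-refl c≈ A.≈-refl q′ , W.E-resp (u.cong p) A.≈-refl d∈)
          ; E-nonempty = λ x →
              let (a , a∈) = δT.E-nonempty x
                  (d , d∈) = W.E-nonempty (u.to x)
                  (_ , c , _ , _ , l , r) = CA.pair-β a d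
              in c , (a , l , a∈) , (d , r , d∈)
          }

        map : AA.AssMorphism domain W
        map = record
          { function = record { to = u.to ; cong = u.cong }
          ; tracked  = CA.snd , proj₂
          }

        section : AB.AssMorphism T (mapAss domain)
        section = record
          { function = record { to = λ x → x ; cong = λ p → p }
          -- From b, `t` yields an element of γ(a) with a in δ(b), and `v` an element of γ(d) with d
          -- realizing u(x); the two are paired by applying an element of γ(`pair`).
          ; tracked  =
              let (t , id≤γδ) = proj₂ γδ≃id
                  (v , track) = u.tracked
                  (ρ , ρ∈) = γ.nonempty CA.pair
                  term = con γ.r ∙ (con γ.r ∙ con ρ ∙ (con t ∙ var zero)) ∙ (con v ∙ var zero)
              in fun term , λ {_} {b} b∈ →
                let (_ , t·b , a , a∈ , tb∈) = id≤γδ b ≈-refl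
                    (_ , v·b , d , d∈ , vb∈) = track b∈
                    (_ , c , p , q , l , r) = CA.pair-β a d
                    (_ , _ , e , e′ , z∈) = realize γ p ρ∈ tb∈
                    (_ , z′ , f , f′ , z′∈) = realize γ q z∈ vb∈
                in z′
                 , fun-β term (⇓app (⇓app ⇓con-refl
                     (⇓app (⇓app ⇓con-refl ⇓con-refl e) (⇓app ⇓con-refl ⇓var-refl t·b) e′) f)
                     (⇓app ⇓con-refl ⇓var-refl v·b) f′)
                 , c , ((a , l , b , b∈ , a∈) , (d , r , d∈)) , z′∈
          }

        retraction : AB.AssMorphism (mapAss domain) T
        retraction = record
          { function = record { to = λ x → x ; cong = λ p → p }
          -- Project under γ to reach γ(a) with a in δ(b); then γδ ≤ id returns b itself.
          ; tracked  =
              let (s , γδ≤id) = proj₁ γδ≃id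
                  term = con s ∙ realizer CA.fst
              in fun term , λ (c , ((a , l , b , b∈ , a∈) , _) , z∈) →
                let (_ , e , y∈) = realizer-⇓ l z∈
                    (b′ , s·y , b≈b′) = γδ≤id b (a , a∈ , y∈)
                in b′ , fun-β term (⇓app ⇓con-refl e s·y) , T.E-resp T.reflˢ b≈b′ b∈
          }

    section⇒lifts : LiftsMaps
    section⇒lifts {T} {W} u =
      domain , map , section , retraction , (λ _ → T.reflˢ) , (λ _ → W.reflˢ)
      where open Lift {T} {W} u

  -- From a split counit to uniform codes

  -- Only `s` and `t` are uniform: nothing yet says that codes of b and b′ can be combined inside
  -- `A` into a code of bb′.
  UniformlyCoded : Set ℓ
  UniformlyCoded = Σ[ s ∈ Carrier ] Σ[ t ∈ Carrier ] ∀ b → Σ[ a ∈ A.Carrier ]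
    (∃ λ z → (t · b ↦ z) × (z ∈ γ.rel a)) × (∀ {z} → z ∈ γ.rel a → s · z ↦ b)

  carrierAss : AB.Assembly
  carrierAss = record
    { setoid     = setoid
    ; E          = _≈_
    ; E-resp     = λ p q r → ≈-trans (≈-sym p) (≈-trans r q)
    ; E-nonempty = λ b → b , ≈-refl
    }

  -- A section makes the second leg of the graph of `ε` a cover, so b yields a realizer of some pair
  -- (w, b) and thence an element of γ(a) with a realizing w. Back from any element of γ(a),
  -- totality of `ε` gives a pair over w, and single-valuedness forces its second component to be b.
  split⇒uniformlyCoded : {W : Quotient}
    (ε : FunctionalRelation (mapQuotient W) (discrete carrierAss))
    (k : FunctionalRelation (discrete carrierAss) (mapQuotient W)) →
    (ε ∘ᶠ k) ≈ᶠ idᶠ {discrete carrierAss} → UniformlyCoded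
  split⇒uniformlyCoded {W} ε k (_ , id⊑) = proj₁ π₂.tracked ⋆ q , proj₁ π₁.tracked ⋆ t , coded
    where
      module ε = FunctionalRelation ε
      module R = Relations.Rel ε.graph
      module W = AA.Assembly (Quotient.base W)
      module G = AB.Assembly R.apex
      module π₁ = AB.AssMorphism R.π₁
      module π₂ = AB.AssMorphism R.π₂

      π₁-surj : AB.TrackedSurjection R.π₁
      π₁-surj = AB.cover⇒surjection {f = R.π₁} ε.total
      q = proj₁ π₁-surj

      π₂-surj : AB.TrackedSurjection R.π₂
      π₂-surj = AB.cover⇒surjection {f = R.π₂}
        (⨾-surjective (FunctionalRelation.graph k) ε.graph {x = Category.id (Ass B)} {z = Category.id (Ass B)}
          (CategoryLemmas.id-cover (Ass B)) id⊑)
      t = proj₁ π₂-surj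

      singleValued : ∀ {g g′} → π₁.to g W.≈ˢ π₁.to g′ → π₂.to g ≈ π₂.to g′
      singleValued {g} {g′} p =
        -- Points are global elements of assemblies, so the internal statement is tested at the
        -- terminal assembly.
        let (_ , l , r) = ε.singleValued {AB.unitAss} {AB.constant (π₁.to g′)}
              {AB.constant (π₂.to g)} {AB.constant (π₂.to g′)}
              (AB.constant g , (λ _ → p) , (λ _ → ≈-refl))
              (AB.constant g′ , (λ _ → W.reflˢ) , (λ _ → ≈-refl))
        in ≈-trans (≈-sym (l _)) (r _)

      coded : ∀ b → Σ[ a ∈ A.Carrier ]
        (∃ λ z → (proj₁ π₁.tracked ⋆ t · b ↦ z) × (z ∈ γ.rel a)) ×
        (∀ {z} → z ∈ γ.rel a → proj₁ π₂.tracked ⋆ q · z ↦ b)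
      coded b =
        let (g , c , g↦b , t·b , c∈) = proj₂ π₂-surj {b} ≈-refl
            (z , e , a , a∈ , z∈) = proj₂ π₁.tracked c∈
        in a , (z , ⋆-β t·b e , z∈) , λ {z′} z′∈ →
          let (g′ , c′ , p , q·z′ , c′∈) = proj₂ π₁-surj (a , a∈ , z′∈)
              (y , e′ , y≈) = proj₂ π₂.tracked c′∈
          in ↦-resp ≈-refl ≈-refl (≈-trans (≈-sym y≈) (≈-trans (singleValued p) g↦b)) (⋆-β q·z′ e′)

  -- Computational density and the applicative section

  module _ (dense : ComputationallyDense γ) where
    private
      m : Carrier
      m = proj₁ dense

      code : Carrier → A.Carrier
      code b = proj₁ (proj₂ dense b)

      -- As γ(a) is nonempty, this says mγ(a) = {b}.
      Codes : Carrier → A.Carrier → Set ℓ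
      Codes b a = ∀ {z} → z ∈ γ.rel a → m · z ↦ b

      -- Density gives mγ(a′) ⊆ sγ(a) = {b} for a′ = `code s` applied to a. Since `code s` depends
      -- on `s` alone, the passage from a to a′ is realized in `A`.
      code-codes : ∀ {s a b} → (∀ {z} → z ∈ γ.rel a → s · z ↦ b) →
                   ∃ λ a′ → (code s A.· a ↦ a′) × Codes b a′
      code-codes {s} {a} sγa =
        let (a′ , e , mγa′↓ , mγa′⊆sγa) = proj₂ (proj₂ dense s) a (λ z∈ → _ , sγa z∈)
        in a′ , e , λ z∈ →
          let (v , m·z) = mγa′↓ z∈
              (_ , x∈ , s·x) = mγa′⊆sγa (_ , z∈ , m·z)
          in ↦-resp ≈-refl ≈-refl (↦-functional s·x (sγa x∈)) m·z

      applyDecoded : Term 1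
      applyDecoded = con m ∙ realizer CA.fst ∙ (con m ∙ realizer CA.snd)

      -- Variable one is the code of the function, variable zero that of the argument. Their pair is
      -- fed to the density code of the element of `B` that decodes both and applies.
      applyCodes : A.Term 2
      applyCodes = A.con (code (fun applyDecoded)) A.∙ (A.con CA.pair A.∙ A.var (suc zero) A.∙ A.var zero)

      applyCodes-correct : ∀ {b b′ bb′ a a′} → b · b′ ↦ bb′ → Codes b a → Codes b′ a′ →
        ∃ λ v → (A.con (CA.fun (CA.ƛ applyCodes)) A.∙ A.con a A.∙ A.con a′ A.⇓ v) × Codes bb′ v
      applyCodes-correct {a = a} {a′} b·b′ a∈ a′∈ =
        let (_ , e , β) = CA.ƛ-correct applyCodes (a ∷ [])
            (_ , c , p , q , l , r) = CA.pair-β a a′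
            (v , code·c , v∈) = code-codes {fun applyDecoded} {c} λ z∈ →
              let (_ , f , x∈) = realizer-⇓ l z∈
                  (_ , g , y∈) = realizer-⇓ r z∈
              in fun-β applyDecoded
                   (⇓app (⇓app ⇓con-refl f (a∈ x∈)) (⇓app ⇓con-refl g (a′∈ y∈)) b·b′)
        in v
         , A.⇓app (A.⇓app CA.⇓con-refl CA.⇓con-refl (CA.fun-β (CA.ƛ applyCodes) e)) CA.⇓con-refl
             (β (A.⇓app CA.⇓con-refl
               (A.⇓app (A.⇓app CA.⇓con-refl CA.⇓var-refl p) CA.⇓var-refl q) code·c))
         , v∈

    -- With δ(b) the set of codes of b, `m` realizes γδ ≤ id. In the other direction `t` reaches
    -- γ(a), and `code s`, applied under γ, moves it to γ of a code.
    uniformlyCoded⇒section : UniformlyCoded → Σ[ δ ∈ ApplicativeMorphism B A ] ((γ ∘ᵃ δ) ≃ idᵃ B)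
    uniformlyCoded⇒section (s , t , coded) =
        record
          { rel      = Codes
          ; rel-resp = λ b≈ a≈ a∈ z∈ →
              ↦-resp ≈-refl ≈-refl b≈ (a∈ (γ.rel-resp (A.≈-sym a≈) ≈-refl z∈))
          ; nonempty = λ b →
              let (_ , _ , sγa) = coded b
                  (a′ , _ , a′∈) = code-codes sγa
              in a′ , a′∈
          ; r        = CA.fun (CA.ƛ applyCodes)
          ; r-law    = applyCodes-correct
          }
      , (m , λ b (_ , a∈ , z∈) → b , a∈ z∈ , ≈-refl)
      , (fun (realizer (code s)) ⋆ t , λ b b≈b′ →
          let (_ , (_ , t·b , z∈) , sγa) = coded b
              (a′ , e , a′∈) = code-codes sγa
              (v , f , v∈) = realizer-⇓ e z∈
          in v , ⋆-β (↦-resp ≈-refl b≈b′ ≈-refl t·b) (fun-β (realizer (code s)) f) , a′ , a′∈ , v∈)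

corollary2p5 : ∀ {ℓ} (A B : PCA ℓ) (γ : ApplicativeMorphism A B) → ComputationallyDense γ →
    (f : GeometricMorphism (RT B) (RT A)) → IsInducedBy f γ →
    IsInclusion f ⇔ (Σ[ δ ∈ ApplicativeMorphism B A ] ((γ ∘ᵃ δ) ≃ idᵃ B))
corollary2p5 A B γ dense f θ = mk⇔
  (λ incl → let (k , εk≈id) = inclusion⇒split incl (discrete (carrierAss γ)) in
    uniformlyCoded⇒section γ dense (split⇒uniformlyCoded γ
      {CouniversalArrow.object (counit-couniversal (discrete (carrierAss γ)))}
      (CouniversalArrow.arrow (counit-couniversal (discrete (carrierAss γ)))) k εk≈id))
  (λ (δ , γδ≃id) → iso⇒inclusion λ Y →
    couniversal⇒iso (section⇒lifts γ δ γδ≃id) (counit-couniversal Y))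
  where
    open InverseImage f (γ* γ) θ
    open ExactCompletionLemmas (regularAss B) using (discrete)
    open RegularExtensionLemmas (regularAss A) (regularAss B) (Induced.γ*-Ass γ) (Induced.γ*-regular γ)
      using (couniversal⇒iso)
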